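{- Let $\mathcal{A}$ be any allocation-monotone greedy algorithm for (fractional) online bipartite matching. Then $\mathcal{A}$ achieves a competitive ratio of at least $\frac{e-1}{e}$ in the random order arrival model; that is, for every finite bipartite graph $G=(L\cup R,E)$, if the vertices of $R$ arrive in a uniformly random order, then the expected value of the fractional matching produced by $\mathcal{A}$ satisfies $$\mathbb{E}\Bigl[\sum_{(i,j)\in E}x_{i,j}\Bigr]\;\ge\;\frac{e-1}{e}\cdot \mathrm{OPT}(G),$$ where $\mathrm{OPT}(G)$ is the maximum value of a fractional matching of $G$.
   Context: Online bipartite matching: $G=(L\cup R,E)$ is a finite bipartite graph; $L$ (offline side) is known in advance, and the vertices of $R$ (online side) arrive one by one. When $j\in R$ arrives, its neighbor set $N(j)\subseteq L$ is revealed and the algorithm must irrevocably choose values $x_{i,j}\ge 0$ for $i\in N(j)$, maintaining a fractional matching. A fractional matching is a vector $(x_{i,j})_{(i,j)\in E}$ with $x_{i,j}\ge 0$, $\sum_{j\in N(i)}x_{i,j}\le 1$ for all $i\in L$, and $\sum_{i\in N(j)}x_{i,j}\le 1$ for all $j\in R$; its value is $\sum_{(i,j)\in E}x_{i,j}$. The water-level $y_i$ of $i\in L$ at a given time is the sum of the values $x_{i,j}$ allocated to $i$ so far. Greedy: an online fractional matching algorithm is greedy if it is not allowed to keep a positive fraction of the arrived vertex unmatched whenever fractional matching is possible (i.e., after $j$ is processed, either $\sum_{i\in N(j)}x_{i,j}=1$ or every $i\in N(j)$ has water-level $1$). Allocation-monotone: fix the offline side $L$. An input sequence $\mathbf{seq}$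 is an ordered set of online vertices, where the data associated with each element also encodes its set of offline neighbors. Let $[\mathbf{seq},j]$ denote the concatenation of $\mathbf{seq}$ with the single-element sequence $(j)$, and let $\mathbf{y}_{\mathrm{old}}(\mathbf{seq})$ and $\mathbf{y}_{\mathrm{new}}(\mathbf{seq})$ denote the vectors of water-levels of the vertices of $L$ when the algorithm is run on $[\mathbf{seq},j]$, respectively before and after it processes $j$. The algorithm is allocation-monotone if for any two input sequences $[\mathbf{seq}_1,j]$ and $[\mathbf{seq}_2,j]$ with $\mathbf{y}_{\mathrm{old}}(\mathbf{seq}_1)\preceq \mathbf{y}_{\mathrm{old}}(\mathbf{seq}_2)$ one has $\mathbf{y}_{\mathrm{new}}(\mathbf{seq}_1)\preceq \mathbf{y}_{\mathrm{new}}(\mathbf{seq}_2)$, where $\preceq$ is element-wise comparison. An allocation-monotone greedy algorithm is one that is both greedy and allocation-monotone. -}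

module Defs where

open import Level using (_⊔_) renaming (suc to lsuc)
open import Algebra.Apartness.Bundles using (HeytingField)
open import Algebra.Bundles using (CommutativeRing)
import Algebra.Apartness.Properties.HeytingCommutativeRing as HeytingProperties
import Algebra.Properties.CommutativeMonoid.Sum as Summation
import Algebra.Properties.Ring as RingProperties
import Algebra.Properties.Semiring.Mult as Multiples
open import Data.Empty using (⊥-elim)
open import Data.Fin.Base using (Fin)
open import Data.Fin.Subset using (Subset; _∈_; _∉_)
open import Data.List.Base using (List; []; _∷_; map; concatMap; foldr; allFin)
open import Data.List.Relation.Unary.Unique.Propositional using (Unique)
open import Data.Nat.Base as ℕ using (ℕ; zero; suc; NonZero; _!)
import Data.Nat.Properties as ℕₚ
open import Data.Nat.Properties using (_!≢0)
open import Data.Product.Base using (∃; _,_; proj₁; proj₂; _×_)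
open import Data.Sum.Base using (_⊎_; inj₁; inj₂; [_,_]′)
open import Function.Base using (_∘_)
open import Function.Definitions using (Injective)
open import Relation.Binary.Core using (Rel)
open import Relation.Binary.PropositionalEquality.Core as ≡ using (_≡_)
open import Relation.Binary.Structures using (IsStrictPartialOrder)
import Relation.Binary.Reasoning.Setoid as ≈-Reasoning
open import Relation.Nullary.Negation using (¬_)

-- ℝ as a Cauchy-complete Archimedean ordered field.  Classically these
-- axioms determine ℝ up to unique isomorphism.  Neither a decidable order
-- nor excluded middle is assumed, so that the axioms also hold in Bishop's
-- constructive reals.
record RealNumbers c ℓ₁ ℓ₂ : Set (lsuc (c ⊔ ℓ₁ ⊔ ℓ₂)) where
  infix 4 _<_ _≤_
  field
    heytingField : HeytingField c ℓ₁ ℓ₂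

  open HeytingField heytingField public

  commutativeRing : CommutativeRing c ℓ₁
  commutativeRing = record { isCommutativeRing = isCommutativeRing }

  open CommutativeRing commutativeRing public
    using (semiring; ring; +-commutativeMonoid)

  -- n · x is the n-fold sum x + ⋯ + x.
  open Multiples semiring public using () renaming (_×_ to _·_)

  field
    _<_                  : Rel Carrier ℓ₂
    isStrictPartialOrder : IsStrictPartialOrder _≈_ _<_
    <⇒#                  : ∀ {x y} → x < y → x # y
    #⇒<⊎>                : ∀ {x y} → x # y → x < y ⊎ y < x
    +-monoˡ-<            : ∀ {x y} z → x < y → x + z < y + z
    *-pos                : ∀ {x y} → 0# < x → 0# < y → 0# < x * y
    archimedean          : ∀ x → ∃ λ n → x < n · 1#

  _≤_ : Rel Carrier ℓ₂
  x ≤ y = ¬ (y < x)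

  Cauchy : (ℕ → Carrier) → Set (c ⊔ ℓ₂)
  Cauchy s = ∀ ε → 0# < ε → ∃ λ N → ∀ m n → N ℕ.≤ m → N ℕ.≤ n → s m - s n < ε

  _⟶_ : (ℕ → Carrier) → Carrier → Set (c ⊔ ℓ₂)
  s ⟶ x = ∀ ε → 0# < ε →
    ∃ λ N → ∀ n → N ℕ.≤ n → (s n - x < ε) × (x - s n < ε)

  field
    complete : ∀ s → Cauchy s → ∃ λ x → s ⟶ x

module RealArithmetic {c ℓ₁ ℓ₂} (ℝ : RealNumbers c ℓ₁ ℓ₂) where
  open RealNumbers ℝ public
  open HeytingProperties heytingCommutativeRing public using (1#0; x-0≈x)
  open RingProperties ring
    using (-‿distribˡ-*; -‿involutive)
  open Multiples semiring
    using (×-congʳ; ×-assoc-*; ×1-homo-*)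
  open Summation +-commutativeMonoid public using (sum)
  private module < = IsStrictPartialOrder isStrictPartialOrder

  infixl 7 _/_[_]

  _/_[_] : ∀ x y → y # 0# → Carrier
  x / y [ y#0 ] = x * proj₁ (#⇒invertible y#0)

  <-cong : ∀ {x x′ y y′} → x ≈ x′ → y ≈ y′ → x < y → x′ < y′
  <-cong p q = <.<-respˡ-≈ p ∘ <.<-respʳ-≈ q

  <-trans : ∀ {x y z} → x < y → y < z → x < z
  <-trans = <.trans

  <-irrefl : ∀ {x} → ¬ (x < x)
  <-irrefl = <.irrefl refl

  <-cotrans : ∀ {x y} → x < y → ∀ z → x < z ⊎ z < y
  <-cotrans x<y z with #-cotrans (<⇒# x<y) z
  ... | inj₁ x#z = [ inj₁ , (λ z<x → inj₂ (<-trans z<x x<y)) ]′ (#⇒<⊎> x#z)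
  ... | inj₂ z#y = [ inj₂ , (λ y<z → inj₁ (<-trans x<y y<z)) ]′ (#⇒<⊎> z#y)

  <⇒≤ : ∀ {x y} → x < y → x ≤ y
  <⇒≤ x<y y<x = <-irrefl (<-trans x<y y<x)

  ≈⇒≤ : ∀ {x y} → x ≈ y → x ≤ y
  ≈⇒≤ x≈y = <.irrefl (sym x≈y)

  <-≤-trans : ∀ {x y z} → x < y → y ≤ z → x < z
  <-≤-trans {z = z} x<y y≤z with <-cotrans x<y z
  ... | inj₁ x<z = x<z
  ... | inj₂ z<y = ⊥-elim (y≤z z<y)

  ≤-<-trans : ∀ {x y z} → x ≤ y → y < z → x < z
  ≤-<-trans {x} x≤y y<z with <-cotrans y<z x
  ... | inj₁ y<x = ⊥-elim (x≤y y<x)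
  ... | inj₂ x<z = x<z

  ≤-trans : ∀ {x y z} → x ≤ y → y ≤ z → x ≤ z
  ≤-trans x≤y y≤z z<x = y≤z (<-≤-trans z<x x≤y)

  +-monoʳ-< : ∀ {x y} z → x < y → z + x < z + y
  +-monoʳ-< z = <-cong (+-comm _ _) (+-comm _ _) ∘ +-monoˡ-< z

  x+y-y≈x : ∀ x y → x + y - y ≈ x
  x+y-y≈x x y =
    trans (+-assoc x y (- y)) (trans (+-congˡ (-‿inverseʳ y)) (+-identityʳ x))

  x-y+y≈x : ∀ x y → x - y + y ≈ x
  x-y+y≈x x y =
    trans (+-assoc x (- y) y) (trans (+-congˡ (-‿inverseˡ y)) (+-identityʳ x))

  +-monoˡ-≤ : ∀ {x y} z → x ≤ y → x + z ≤ y + z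
  +-monoˡ-≤ z x≤y = x≤y ∘ <-cong (x+y-y≈x _ z) (x+y-y≈x _ z) ∘ +-monoˡ-< (- z)

  +-monoʳ-≤ : ∀ {x y} z → x ≤ y → z + x ≤ z + y
  +-monoʳ-≤ z x≤y = +-monoˡ-≤ z x≤y ∘ <-cong (+-comm _ _) (+-comm _ _)

  x≤x+y : ∀ {y} x → 0# < y → x ≤ x + y
  x≤x+y x 0<y = <⇒≤ (<-cong (+-identityʳ x) refl (+-monoʳ-< x 0<y))

  +-pos : ∀ {x y} → 0# < x → 0# < y → 0# < x + y
  +-pos {x} 0<x 0<y = <-≤-trans 0<x (x≤x+y x 0<y)

  x<0⇒0<-x : ∀ {x} → x < 0# → 0# < - x
  x<0⇒0<-x {x} = <-cong (-‿inverseʳ x) (+-identityˡ (- x)) ∘ +-monoˡ-< (- x)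

  *-monoʳ-< : ∀ {x y z} → 0# < z → x < y → z * x < z * y
  *-monoʳ-< {x} {y} {z} 0<z x<y =
    <-cong (+-identityˡ (z * x)) eq (+-monoˡ-< (z * x) (*-pos 0<z 0<y-x))
    where
    0<y-x : 0# < y - x
    0<y-x = <-cong (-‿inverseʳ x) refl (+-monoˡ-< (- x) x<y)
    eq : z * (y - x) + z * x ≈ z * y
    eq = trans (sym (distribˡ z (y - x) x)) (*-congˡ (x-y+y≈x y x))

  0<1 : 0# < 1#
  0<1 with #⇒<⊎> 1#0
  ... | inj₂ 0<1 = 0<1
  ... | inj₁ 1<0 = ⊥-elim (<⇒≤ 1<0 (<-cong refl eq (*-pos 0<-1 0<-1)))
    where
    0<-1 : 0# < - 1#
    0<-1 = x<0⇒0<-x 1<0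
    eq : - 1# * - 1# ≈ 1#
    eq = trans (sym (-‿distribˡ-* 1# (- 1#)))
               (trans (-‿cong (*-identityˡ (- 1#))) (-‿involutive 1#))

  >⇒#0 : ∀ {x} → 0# < x → x # 0#
  >⇒#0 = #-sym ∘ <⇒#

  x*1/x≈1 : ∀ {x} (x#0 : x # 0#) → x * (1# / x [ x#0 ]) ≈ 1#
  x*1/x≈1 {x} x#0 = trans (*-congˡ (*-identityˡ _))
    (trans (*-congʳ (sym (x-0≈x x))) (proj₂ (proj₂ (#⇒invertible x#0))))

  1/-pos : ∀ {x} (0<x : 0# < x) → 0# < 1# / x [ >⇒#0 0<x ]
  1/-pos {x} 0<x with #⇒<⊎> x⁻¹#0
    where
    x⁻¹ : Carrier
    x⁻¹ = 1# / x [ >⇒#0 0<x ]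
    x⁻¹#0 : x⁻¹ # 0#
    x⁻¹#0 = invertible⇒#
      ( x
      , trans (*-congˡ (x-0≈x x⁻¹)) (x*1/x≈1 (>⇒#0 0<x))
      , trans (*-congʳ (x-0≈x x⁻¹)) (trans (*-comm _ _) (x*1/x≈1 (>⇒#0 0<x))))
  ... | inj₂ 0<x⁻¹ = 0<x⁻¹
  ... | inj₁ x⁻¹<0 = ⊥-elim (<⇒≤ 0<1
    (<-cong (x*1/x≈1 (>⇒#0 0<x)) (zeroʳ x) (*-monoʳ-< 0<x x⁻¹<0)))

  ·-nonneg : ∀ n {x} → 0# < x → 0# ≤ n · x
  ·-nonneg zero    0<x = ≈⇒≤ refl
  ·-nonneg (suc n) 0<x =
    ≤-trans (<⇒≤ 0<x)
      (≤-trans (≈⇒≤ (sym (+-identityʳ _))) (+-monoʳ-≤ _ (·-nonneg n 0<x)))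

  ·-pos : ∀ n .{{_ : NonZero n}} {x} → 0# < x → 0# < n · x
  ·-pos (suc n) {x} 0<x =
    <-≤-trans (<-cong refl (sym (+-identityʳ x)) 0<x)
      (+-monoʳ-≤ x (·-nonneg n 0<x))

  ·-monoˡ-≤ : ∀ {m n x} → 0# < x → m ℕ.≤ n → m · x ≤ n · x
  ·-monoˡ-≤ {n = n} 0<x ℕ.z≤n       = ·-nonneg n 0<x
  ·-monoˡ-≤ {x = x} 0<x (ℕ.s≤s m≤n) = +-monoʳ-≤ x (·-monoˡ-≤ 0<x m≤n)

  ·1-* : ∀ n x → (n · 1#) * x ≈ n · x
  ·1-* n x = trans (×-assoc-* n 1# x) (×-congʳ n (*-identityˡ x))

  *-monoʳ-≤ : ∀ {x y z} → 0# < z → x ≤ y → z * x ≤ z * y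
  *-monoʳ-≤ {x} {y} {z} 0<z x≤y zy<zx =
    x≤y (<-cong (cancel y) (cancel x) (*-monoʳ-< (1/-pos 0<z) zy<zx))
    where
    z⁻¹ = 1# / z [ >⇒#0 0<z ]
    cancel : ∀ w → z⁻¹ * (z * w) ≈ w
    cancel w = begin
      z⁻¹ * (z * w)   ≈⟨ *-assoc z⁻¹ z w ⟨
      z⁻¹ * z * w     ≈⟨ *-congʳ (trans (*-comm z⁻¹ z) (x*1/x≈1 (>⇒#0 0<z))) ⟩
      1# * w          ≈⟨ *-identityˡ w ⟩
      w               ∎
      where open ≈-Reasoning setoid

  abstract
    !·1#0 : ∀ n → (n !) · 1# # 0#
    !·1#0 n = >⇒#0 (·-pos (n !) {{n !≢0}} 0<1)

  1/!_ : ℕ → Carrier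
  1/! n = 1# / (n !) · 1# [ !·1#0 n ]

  abstract
    1/!-pos : ∀ n → 0# < 1/! n
    1/!-pos n = 1/-pos (·-pos (n !) {{n !≢0}} 0<1)

  -- 1/0! + 1/1! + ⋯ + 1/(n-1)!
  ∑1/! : ℕ → Carrier
  ∑1/! zero    = 0#
  ∑1/! (suc n) = ∑1/! n + 1/! n

  1/!-suc : ∀ n → 1/! n ≈ suc n · (1/! suc n)
  1/!-suc n = begin
    u                                            ≈⟨ *-identityʳ u ⟨
    u * 1#                                       ≈⟨ *-congˡ (x*1/x≈1 (!·1#0 (suc n))) ⟨
    u * (((suc n ℕ.* n !) · 1#) * u′)            ≈⟨ *-congˡ (*-congʳ (×1-homo-* (suc n) (n !))) ⟩
    u * (((suc n · 1#) * ((n !) · 1#)) * u′)     ≈⟨ *-congˡ (*-congʳ (*-comm _ _)) ⟩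
    u * ((((n !) · 1#) * (suc n · 1#)) * u′)     ≈⟨ *-congˡ (*-assoc _ _ _) ⟩
    u * (((n !) · 1#) * ((suc n · 1#) * u′))     ≈⟨ *-assoc _ _ _ ⟨
    u * ((n !) · 1#) * ((suc n · 1#) * u′)       ≈⟨ *-congʳ (*-comm _ _) ⟩
    ((n !) · 1#) * u * ((suc n · 1#) * u′)       ≈⟨ *-congʳ (x*1/x≈1 (!·1#0 n)) ⟩
    1# * ((suc n · 1#) * u′)                     ≈⟨ *-identityˡ _ ⟩
    (suc n · 1#) * u′                            ≈⟨ ·1-* (suc n) u′ ⟩
    suc n · u′                                   ∎
    where
    open ≈-Reasoning setoid
    u  = 1/! n
    u′ = 1/! suc n

  -- ∑1/! n is bounded above, and from n = 1 on the bound is antitone.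
  bound : ℕ → Carrier
  bound n = ∑1/! n + (1/! n + 1/! n)

  bound-antitone : ∀ n → bound (2 ℕ.+ n) ≤ bound (1 ℕ.+ n)
  bound-antitone n =
    ≤-trans (+-monoʳ-≤ _ twice) (≈⇒≤ (+-assoc _ _ _))
    where
    u′ = 1/! (2 ℕ.+ n)
    twice : u′ + u′ ≤ 1/! (1 ℕ.+ n)
    twice = ≤-trans
      (+-monoʳ-≤ u′ (≤-trans (≈⇒≤ (sym (+-identityʳ u′)))
                             (+-monoʳ-≤ u′ (·-nonneg n (1/!-pos (2 ℕ.+ n))))))
      (≈⇒≤ (sym (1/!-suc (1 ℕ.+ n))))

  ∑1/!-mono : ∀ {m n} → m ℕ.≤′ n → ∑1/! m ≤ ∑1/! n
  ∑1/!-mono (ℕ.≤′-reflexive ≡.refl) = ≈⇒≤ refl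
  ∑1/!-mono (ℕ.≤′-step {n} m≤n)     =
    ≤-trans (∑1/!-mono m≤n) (x≤x+y (∑1/! n) (1/!-pos n))

  ∑1/!≤bound : ∀ {m n} → suc m ℕ.≤′ n → ∑1/! n ≤ bound (suc m)
  ∑1/!≤bound {m} {n} m<n =
    ≤-trans (x≤x+y _ (+-pos (1/!-pos n) (1/!-pos n))) (go m<n)
    where
    go : ∀ {n} → suc m ℕ.≤′ n → bound n ≤ bound (suc m)
    go (ℕ.≤′-reflexive ≡.refl)       = ≈⇒≤ refl
    go (ℕ.≤′-step {zero}  m<0)       with () ← ℕₚ.≤′⇒≤ m<0
    go (ℕ.≤′-step {suc n} m<n)       = ≤-trans (bound-antitone n) (go m<n)

  abstract
    2/!-small : ∀ ε → 0# < ε → ∃ λ k → 1/! suc k + 1/! suc k < ε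
    2/!-small ε 0<ε = k , <-≤-trans 2u<εku (≤-trans εku≤ε (≈⇒≤ (*-identityʳ ε)))
      where
      ε⁻¹ : Carrier
      ε⁻¹ = 1# / ε [ >⇒#0 0<ε ]
      k : ℕ
      k = proj₁ (archimedean ((1# + 1#) * ε⁻¹))
      u : Carrier
      u = 1/! suc k

      2<εk : 1# + 1# < ε * (k · 1#)
      2<εk = <-cong eq refl (*-monoʳ-< 0<ε (proj₂ (archimedean ((1# + 1#) * ε⁻¹))))
        where
        open ≈-Reasoning setoid
        eq : ε * ((1# + 1#) * ε⁻¹) ≈ 1# + 1#
        eq = begin
          ε * ((1# + 1#) * ε⁻¹)   ≈⟨ *-congˡ (*-comm _ _) ⟩
          ε * (ε⁻¹ * (1# + 1#))   ≈⟨ *-assoc _ _ _ ⟨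
          ε * ε⁻¹ * (1# + 1#)     ≈⟨ *-congʳ (x*1/x≈1 (>⇒#0 0<ε)) ⟩
          1# * (1# + 1#)          ≈⟨ *-identityˡ _ ⟩
          1# + 1#                 ∎

      2u<εku : u + u < ε * (k · u)
      2u<εku = <-cong eq₁ eq₂ (*-monoʳ-< (1/!-pos (suc k)) 2<εk)
        where
        open ≈-Reasoning setoid
        eq₁ : u * (1# + 1#) ≈ u + u
        eq₁ = trans (distribˡ u 1# 1#) (+-cong (*-identityʳ u) (*-identityʳ u))
        eq₂ : u * (ε * (k · 1#)) ≈ ε * (k · u)
        eq₂ = begin
          u * (ε * (k · 1#))   ≈⟨ *-comm _ _ ⟩
          ε * (k · 1#) * u     ≈⟨ *-assoc _ _ _ ⟩
          ε * ((k · 1#) * u)   ≈⟨ *-congˡ (·1-* k u) ⟩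
          ε * (k · u)          ∎

      k≤[1+k]! : k ℕ.≤ suc k !
      k≤[1+k]! = ℕₚ.≤-trans (ℕₚ.n≤1+n k) (ℕₚ.m≤m*n (suc k) (k !) {{k !≢0}})

      εku≤ε : ε * (k · u) ≤ ε * 1#
      εku≤ε = *-monoʳ-≤ 0<ε
        (≤-trans (·-monoˡ-≤ (1/!-pos (suc k)) k≤[1+k]!)
          (≈⇒≤ (trans (sym (·1-* (suc k !) u)) (x*1/x≈1 (!·1#0 (suc k))))))

    ∑1/!-cauchy : Cauchy ∑1/!
    ∑1/!-cauchy ε 0<ε = suc k , close
      where
      k : ℕ
      k = proj₁ (2/!-small ε 0<ε)
      s 2u : Carrier
      s = ∑1/! (suc k)
      2u = 1/! suc k + 1/! suc k
      s+2u<ε+s : s + 2u < ε + s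
      s+2u<ε+s = <-cong (+-comm 2u s) refl (+-monoˡ-< s (proj₂ (2/!-small ε 0<ε)))
      close : ∀ m n → suc k ℕ.≤ m → suc k ℕ.≤ n → ∑1/! m - ∑1/! n < ε
      close m n k<m k<n =
        <-cong refl (x+y-y≈x ε (∑1/! n)) (+-monoˡ-< (- ∑1/! n) sₘ<ε+sₙ)
        where
        sₘ<ε+sₙ : ∑1/! m < ε + ∑1/! n
        sₘ<ε+sₙ = <-≤-trans {y = ε + s}
          (≤-<-trans {y = s + 2u} (∑1/!≤bound (ℕₚ.≤⇒≤′ k<m)) s+2u<ε+s)
          (+-monoʳ-≤ ε (∑1/!-mono (ℕₚ.≤⇒≤′ k<n)))

  e : Carrier
  e = proj₁ (complete ∑1/! ∑1/!-cauchy)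

  ∑1/!⟶e : ∑1/! ⟶ e
  ∑1/!⟶e = proj₂ (complete ∑1/! ∑1/!-cauchy)

  abstract
    0<e : 0# < e
    0<e = <-cong (-‿inverseʳ u) eq (+-monoˡ-< (- u) u<u+e)
      where
      u : Carrier
      u = 1/! 0
      near : ∃ λ N → ∀ n → N ℕ.≤ n → (∑1/! n - e < u) × (e - ∑1/! n < u)
      near = ∑1/!⟶e u (1/!-pos 0)
      N : ℕ
      N = proj₁ near
      u≤s : u ≤ ∑1/! (suc N)
      u≤s = ≤-trans (≈⇒≤ (sym (+-identityˡ u)))
                    (∑1/!-mono {1} {suc N} (ℕₚ.≤⇒≤′ (ℕ.s≤s ℕ.z≤n)))
      u-e<u : u - e < u
      u-e<u = ≤-<-trans (+-monoˡ-≤ (- e) u≤s) (proj₁ (proj₂ near (suc N) (ℕₚ.n≤1+n N)))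
      u<u+e : u < u + e
      u<u+e = <-cong (x-y+y≈x u e) refl (+-monoˡ-< e u-e<u)
      eq : u + e - u ≈ e
      eq = trans (+-congʳ (+-comm u e)) (x+y-y≈x e u)

-- The offline side is L = Fin l.  The data of an online vertex are its
-- identity and its set of offline neighbours.
record OnlineVertex (V : Set) (l : ℕ) : Set where
  constructor onlineVertex
  field
    identity : V
    N        : Subset l

open OnlineVertex public

-- Input sequences are snoc lists: the head is the vertex that arrived last,
-- so [seq , j] is j ∷ seq.
Sequence : Set → ℕ → Set
Sequence V l = List (OnlineVertex V l)

-- An input sequence is an ordered set: no online vertex arrives twice.
IsInput : ∀ {V l} → Sequence V l → Set
IsInput seq = Unique (map identity seq)

record BipartiteGraph (V : Set) (l : ℕ) : Set where
  field
    r         : ℕ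
    label     : Fin r → V
    label-inj : Injective _≡_ _≡_ label
    nbhd      : Fin r → Subset l

  vertex : Fin r → OnlineVertex V l
  vertex j = onlineVertex (label j) (nbhd j)

insertions : ∀ {a} {A : Set a} → A → List A → List (List A)
insertions x []       = (x ∷ []) ∷ []
insertions x (y ∷ ys) = (x ∷ y ∷ ys) ∷ map (y ∷_) (insertions x ys)

-- All orderings of a list; each of the r ! orderings of allFin r occurs
-- exactly once in permutations (allFin r).
permutations : ∀ {a} {A : Set a} → List A → List (List A)
permutations []       = [] ∷ []
permutations (x ∷ xs) = concatMap (insertions x) (permutations xs)

module OnlineMatching {c ℓ₁ ℓ₂} (ℝ : RealNumbers c ℓ₁ ℓ₂) where
  open RealArithmetic ℝ

  -- Allocations are total functions of the offline vertex that vanish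
  -- off the edges.

  module _ {V l} (G : BipartiteGraph V l) where
    open BipartiteGraph G

    record IsFractionalMatching (x : Fin l → Fin r → Carrier)
           : Set (ℓ₁ ⊔ ℓ₂) where
      field
        nonneg  : ∀ i j → 0# ≤ x i j
        support : ∀ i j → i ∉ nbhd j → x i j ≈ 0#
        offline : ∀ i → sum (λ j → x i j) ≤ 1#
        online  : ∀ j → sum (λ i → x i j) ≤ 1#

    value : (Fin l → Fin r → Carrier) → Carrier
    value x = sum (λ i → sum (λ j → x i j))

    IsOPT : Carrier → Set (c ⊔ ℓ₁ ⊔ ℓ₂)
    IsOPT v = (∃ λ x → IsFractionalMatching x × value x ≈ v)
            × (∀ x → IsFractionalMatching x → value x ≤ v)

  -- The values allocated to an arriving vertex may depend on everything
  -- that arrived before it.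
  Rule : Set → ℕ → Set c
  Rule V l = Sequence V l → OnlineVertex V l → Fin l → Carrier

  levels : ∀ {V l} → Rule V l → Sequence V l → Fin l → Carrier
  levels x []        i = 0#
  levels x (j ∷ seq) i = levels x seq i + x seq j i

  record OnlineAlgorithm (V : Set) (l : ℕ) : Set (c ⊔ ℓ₁ ⊔ ℓ₂) where
    field
      x : Rule V l

    waterLevel : Sequence V l → Fin l → Carrier
    waterLevel = levels x

    field
      nonneg  : ∀ seq j → IsInput (j ∷ seq) → ∀ i → 0# ≤ x seq j i
      support : ∀ seq j → IsInput (j ∷ seq) → ∀ i → i ∉ N j → x seq j i ≈ 0#
      offline : ∀ seq → IsInput seq → ∀ i → waterLevel seq i ≤ 1#
      online  : ∀ seq j → IsInput (j ∷ seq) → sum (x seq j) ≤ 1#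

  module _ {V l} (A : OnlineAlgorithm V l) where
    open OnlineAlgorithm A

    -- The double negation makes the disjunction classical; it only weakens
    -- the requirement where the order on ℝ is undecidable.
    Greedy : Set ℓ₁
    Greedy = ∀ seq j → IsInput (j ∷ seq) →
      ¬ ¬ (sum (x seq j) ≈ 1# ⊎ (∀ i → i ∈ N j → waterLevel (j ∷ seq) i ≈ 1#))

    AllocationMonotone : Set ℓ₂
    AllocationMonotone = ∀ seq₁ seq₂ j → IsInput (j ∷ seq₁) → IsInput (j ∷ seq₂) →
      (∀ i → waterLevel seq₁ i ≤ waterLevel seq₂ i) →
      (∀ i → waterLevel (j ∷ seq₁) i ≤ waterLevel (j ∷ seq₂) i)

    matched : Sequence V l → Carrier
    matched []        = 0#
    matched (j ∷ seq) = matched seq + sum (x seq j)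

    expectedMatched : BipartiteGraph V l → Carrier
    expectedMatched G =
      foldr _+_ 0# (map (λ π → matched (map vertex π)) (permutations (allFin r)))
        / (r !) · 1# [ !·1#0 r ]
      where open BipartiteGraph G

{-# OPTIONS --safe #-}
module Submission where

-- Let the online vertices arrive at independent uniform times in [0,1], and
-- let F(t) be the expected amount matched by time t.  If j arrives at time t,
-- greediness gives 1 ≤ y_i + z_j for every neighbour i, where y_i is the level
-- of i before j arrives and z_j the amount that j receives.  By
-- allocation-monotonicity, re-inserting j at an independent random time only
-- raises the levels at time t, so that the averages of y and z form a feasible
-- dual solution and OPT ≤ F(t) + F′(t).  Hence e F(1) ≥ (e - 1) OPT.
-- No integral is needed: F is a polynomial in t, and integrating the inequality
-- against t^m gives a weighted sum over the arrival orders in which the history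
-- of length k has weight C(m+k, k).  Adding up these inequalities with factors
-- 1/m! yields the bound with e replaced by a partial sum of its series.

open import Algebra.Bundles using (CommutativeRing)
import Algebra.Properties.CommutativeMonoid.Mult as CommutativeMonoidMult
import Algebra.Properties.CommutativeMonoid.Sum as CommutativeMonoidSum
import Algebra.Properties.Semiring.Mult as SemiringMult
import Algebra.Properties.Semiring.Sum as SemiringSum
import Algebra.Solver.Ring.NaturalCoefficients.Default as NaturalCoefficients
open import Data.Empty using (⊥-elim)
open import Data.Fin.Base using (Fin; zero; suc)
open import Data.Fin.Properties using (_≟_)
open import Data.Fin.Subset using (_∈_)
open import Data.Fin.Subset.Properties using (_∈?_)
open import Data.List.Base using (List; []; _∷_; _++_; length; map; concatMap; foldr; allFin)
open import Data.List.Membership.Propositional.Properties using (∈-∃++; ∈-allFin)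
open import Data.List.Properties using (length-map; map-∘; length-tabulate)
open import Data.List.Relation.Binary.Permutation.Propositional as ↭
  using (_↭_; prep; ↭-refl; ↭-sym; ↭-trans; ↭⇒↭ₛ)
open import Data.List.Relation.Binary.Permutation.Propositional.Properties
  using (↭-length; shift)
open import Data.List.Relation.Binary.Permutation.Setoid.Properties using (Unique-resp-↭)
open import Data.List.Relation.Unary.All as All using (All; []; _∷_)
import Data.List.Relation.Unary.All.Properties as All
open import Data.List.Relation.Unary.AllPairs using (_∷_; head; tail)
open import Data.List.Relation.Unary.Unique.Propositional using (Unique)
import Data.List.Relation.Unary.Unique.Propositional.Properties as Unique
open import Data.Nat.Base as ℕ using (ℕ; zero; suc; _!)
import Data.Nat.Properties as ℕₚ
import Data.Nat.Solver as ℕ-Solver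
open import Data.Product.Base using (∃; _,_; proj₁; proj₂; _×_)
open import Data.Sum.Base using ([_,_]′)
open import Function.Base using (_∘_; id)
open import Relation.Binary.Bundles using (Preorder)
open import Relation.Binary.PropositionalEquality.Core as ≡ using (_≡_; _≢_)
open import Relation.Binary.PropositionalEquality.Properties as ≡ using (module ≡-Reasoning)
import Relation.Binary.Reasoning.Preorder as PreorderReasoning
import Relation.Binary.Reasoning.Setoid as ≈-Reasoning
open import Relation.Nullary.Decidable.Core using (Dec; yes; no)
open import Defs

-- Multiset coefficients.

-- The number of multisets of size k drawn from m kinds, C(m+k-1, k).
multichoose : ℕ → ℕ → ℕ
multichoose zero    zero    = 1
multichoose zero    (suc k) = 0
multichoose (suc m) zero    = 1
multichoose (suc m) (suc k) = multichoose m (suc k) ℕ.+ multichoose (suc m) k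

multichoose-zero : ∀ m → multichoose m 0 ≡ 1
multichoose-zero zero    = ≡.refl
multichoose-zero (suc m) = ≡.refl

-- Absorption for binomial coefficients. The step expands by Pascal's rule and uses the identity at
-- `(m, suc k)` and at `(suc m, k)`.
multichoose-absorb : ∀ m k → suc k ℕ.* multichoose m (suc k) ≡ (m ℕ.+ k) ℕ.* multichoose m k
multichoose-absorb zero    zero    = ≡.refl
multichoose-absorb zero    (suc k) = ≡.trans (ℕₚ.*-zeroʳ k) (≡.sym (ℕₚ.*-zeroʳ k))
multichoose-absorb (suc m) zero    = begin
  1 ℕ.* (multichoose m 1 ℕ.+ 1)       ≡⟨ ℕₚ.*-distribˡ-+ 1 (multichoose m 1) 1 ⟩
  1 ℕ.* multichoose m 1 ℕ.+ 1         ≡⟨ ≡.cong (ℕ._+ 1) (multichoose-absorb m 0) ⟩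
  (m ℕ.+ 0) ℕ.* multichoose m 0 ℕ.+ 1 ≡⟨ ≡.cong (λ b → (m ℕ.+ 0) ℕ.* b ℕ.+ 1) (multichoose-zero m) ⟩
  (m ℕ.+ 0) ℕ.* 1 ℕ.+ 1               ≡⟨ ℕₚ.+-comm _ 1 ⟩
  (suc m ℕ.+ 0) ℕ.* 1                 ∎
  where open ≡-Reasoning
multichoose-absorb (suc m) (suc k) = begin
  (2 ℕ.+ k) ℕ.* (p ℕ.+ q)
    ≡⟨ solve 3 (λ k p q → (con 2 :+ k) :* (p :+ q)
                       := (con 1 :+ (con 1 :+ k)) :* p :+ (con 2 :+ k) :* q) ≡.refl k p q ⟩
  suc (suc k) ℕ.* p ℕ.+ (2 ℕ.+ k) ℕ.* q
    ≡⟨ ≡.cong (ℕ._+ (2 ℕ.+ k) ℕ.* q) (multichoose-absorb m (suc k)) ⟩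
  (m ℕ.+ suc k) ℕ.* r ℕ.+ (2 ℕ.+ k) ℕ.* q
    ≡⟨ solve 4 (λ m k r q → (m :+ (con 1 :+ k)) :* r :+ (con 2 :+ k) :* q
                         := (m :+ (con 1 :+ k)) :* r :+ q :+ (con 1 :+ k) :* q) ≡.refl m k r q ⟩
  (m ℕ.+ suc k) ℕ.* r ℕ.+ q ℕ.+ suc k ℕ.* q
    ≡⟨ ≡.cong ((m ℕ.+ suc k) ℕ.* r ℕ.+ q ℕ.+_) (multichoose-absorb (suc m) k) ⟩
  (m ℕ.+ suc k) ℕ.* r ℕ.+ q ℕ.+ (suc m ℕ.+ k) ℕ.* s
    ≡⟨ solve 4 (λ m k r s →
         (m :+ (con 1 :+ k)) :* r :+ (r :+ s) :+ (con 1 :+ m :+ k) :* s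
           := (con 1 :+ m :+ (con 1 :+ k)) :* (r :+ s)) ≡.refl m k r s ⟩
  (suc m ℕ.+ suc k) ℕ.* q ∎
  where
  open ≡-Reasoning
  open ℕ-Solver.+-*-Solver
  p = multichoose m (2 ℕ.+ k)
  q = multichoose (suc m) (suc k)
  r = multichoose m (suc k)
  s = multichoose (suc m) k

-- The factorial formula for C(n+m, n), by absorption along `n`. It is stated multiplicatively so
-- that it stays within ℕ.
multichoose-! : ∀ m n → multichoose (suc m) n ℕ.* n ! ℕ.* m ! ≡ (n ℕ.+ m) !
multichoose-! m zero    = ℕₚ.*-identityˡ (m !)
multichoose-! m (suc n) = begin
  b ℕ.* (suc n ℕ.* n !) ℕ.* m !
    ≡⟨ solve 4 (λ b n x y → b :* ((con 1 :+ n) :* x) :* y := (con 1 :+ n) :* b :* (x :* y))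
         ≡.refl b n (n !) (m !) ⟩
  suc n ℕ.* b ℕ.* (n ! ℕ.* m !)
    ≡⟨ ≡.cong (ℕ._* (n ! ℕ.* m !)) (multichoose-absorb (suc m) n) ⟩
  (suc m ℕ.+ n) ℕ.* b′ ℕ.* (n ! ℕ.* m !)
    ≡⟨ solve 5 (λ b n m x y → (con 1 :+ m :+ n) :* b :* (x :* y)
                           := (con 1 :+ n :+ m) :* (b :* x :* y)) ≡.refl b′ n m (n !) (m !) ⟩
  (suc n ℕ.+ m) ℕ.* (b′ ℕ.* n ! ℕ.* m !)
    ≡⟨ ≡.cong ((suc n ℕ.+ m) ℕ.*_) (multichoose-! m n) ⟩
  (suc n ℕ.+ m) ! ∎
  where
  open ≡-Reasoning
  open ℕ-Solver.+-*-Solver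
  b = multichoose (suc m) (suc n)
  b′ = multichoose (suc m) n

-- Insertions and permutations of lists.

module _ {a} {A : Set a} where

  insertions-↭ : ∀ x (xs : List A) → All (_↭ x ∷ xs) (insertions x xs)
  insertions-↭ x []       = ↭-refl ∷ []
  insertions-↭ x (y ∷ ys) = ↭-refl ∷
    All.map⁺ (All.map (λ p → ↭-trans (prep y p) (↭.swap y x ↭-refl)) (insertions-↭ x ys))

  length-insertions : ∀ x (xs : List A) → length (insertions x xs) ≡ suc (length xs)
  length-insertions x []       = ≡.refl
  length-insertions x (y ∷ ys) =
    ≡.cong suc (≡.trans (length-map (y ∷_) (insertions x ys)) (length-insertions x ys))

  permutations-↭ : ∀ (xs : List A) → All (_↭ xs) (permutations xs)
  permutations-↭ []       = ↭-refl ∷ []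
  permutations-↭ (x ∷ xs) = All.concat⁺ (All.map⁺ (All.map
    (λ {ys} p → All.map (λ q → ↭-trans q (prep x p)) (insertions-↭ x ys)) (permutations-↭ xs)))

-- Facts about ordered fields

module OrderedField {c ℓ₁ ℓ₂} (ℝ : RealNumbers c ℓ₁ ℓ₂) where
  open RealArithmetic ℝ hiding (zero)
  open CommutativeRing commutativeRing using (commutativeSemiring)
  open CommutativeMonoidMult +-commutativeMonoid public using (×-distrib-+)
  open SemiringMult semiring public
    using (×-congʳ; ×-congˡ; ×-assocˡ; ×-homo-+; ×-assoc-*; ×-comm-*)
  open NaturalCoefficients commutativeSemiring public using (solve; _:=_; _:+_; _:*_; con)

  ≤-refl : ∀ {x} → x ≤ x
  ≤-refl = ≈⇒≤ refl

  ≤-preorder : Preorder c ℓ₁ ℓ₂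
  ≤-preorder = record
    { isPreorder = record { isEquivalence = isEquivalence ; reflexive = ≈⇒≤ ; trans = ≤-trans } }

  module ≤-Reasoning = PreorderReasoning ≤-preorder

  +-mono-≤ : ∀ {w x y z} → w ≤ x → y ≤ z → w + y ≤ x + z
  +-mono-≤ {x = x} {y = y} w≤x y≤z = ≤-trans (+-monoˡ-≤ y w≤x) (+-monoʳ-≤ x y≤z)

  +-cancelʳ-≤ : ∀ {x y} z → x + z ≤ y + z → x ≤ y
  +-cancelʳ-≤ {x} {y} z p =
    ≤-trans (≈⇒≤ (sym (x+y-y≈x x z))) (≤-trans (+-monoˡ-≤ (- z) p) (≈⇒≤ (x+y-y≈x y z)))

  +-nonneg : ∀ {x y} → 0# ≤ x → 0# ≤ y → 0# ≤ x + y
  +-nonneg 0≤x 0≤y = ≤-trans (≈⇒≤ (sym (+-identityʳ 0#))) (+-mono-≤ 0≤x 0≤y)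

  x≤x+nonneg : ∀ {y} x → 0# ≤ y → x ≤ x + y
  x≤x+nonneg x 0≤y = ≤-trans (≈⇒≤ (sym (+-identityʳ x))) (+-monoʳ-≤ x 0≤y)

  -- The order is negative, so a nonnegative factor may be assumed to be
  -- either positive or zero.
  *-monoʳ-≤-nonneg : ∀ {x y z} → 0# ≤ z → x ≤ y → z * x ≤ z * y
  *-monoʳ-≤-nonneg {x} {y} {z} 0≤z x≤y zy<zx = <-irrefl (<-cong (z*≈0 y) (z*≈0 x) zy<zx)
    where
    z≈0 : z ≈ 0#
    z≈0 = proj₁ (tight z 0#)
      ([ 0≤z , (λ 0<z → *-monoʳ-≤ 0<z x≤y zy<zx) ]′ ∘ #⇒<⊎>)
    z*≈0 : ∀ w → z * w ≈ 0#
    z*≈0 w = trans (*-congʳ z≈0) (zeroˡ w)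

  *-monoˡ-≤-nonneg : ∀ {x y z} → 0# ≤ z → x ≤ y → x * z ≤ y * z
  *-monoˡ-≤-nonneg 0≤z x≤y =
    ≤-trans (≈⇒≤ (*-comm _ _)) (≤-trans (*-monoʳ-≤-nonneg 0≤z x≤y) (≈⇒≤ (*-comm _ _)))

  *-nonneg : ∀ {x y} → 0# ≤ x → 0# ≤ y → 0# ≤ x * y
  *-nonneg {x} 0≤x 0≤y = ≤-trans (≈⇒≤ (sym (zeroʳ x))) (*-monoʳ-≤-nonneg 0≤x 0≤y)

  *-cancelˡ-≤ : ∀ {x y z} → 0# < z → z * x ≤ z * y → x ≤ y
  *-cancelˡ-≤ 0<z zx≤zy = zx≤zy ∘ *-monoʳ-< 0<z

  *-cancelˡ-< : ∀ {x y z} → 0# < z → z * x < z * y → x < y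
  *-cancelˡ-< {x} {y} {z} 0<z zx<zy =
    <-cong (cancel x) (cancel y) (*-monoʳ-< (1/-pos 0<z) zx<zy)
    where
    cancel : ∀ w → 1# / z [ >⇒#0 0<z ] * (z * w) ≈ w
    cancel w = trans (sym (*-assoc _ _ _))
      (trans (*-congʳ (trans (*-comm _ _) (x*1/x≈1 (>⇒#0 0<z)))) (*-identityˡ w))

  *-/ : ∀ {x} y (x#0 : x # 0#) → x * (y / x [ x#0 ]) ≈ y
  *-/ {x} y x#0 = begin
    x * (y * x⁻¹)          ≈⟨ solve 3 (λ x y i → x :* (y :* i) := y :* (x :* i)) refl x y x⁻¹ ⟩
    y * (x * x⁻¹)          ≈⟨ *-congˡ (*-congˡ (*-identityˡ x⁻¹)) ⟨
    y * (x * (1# * x⁻¹))   ≈⟨ *-congˡ (x*1/x≈1 x#0) ⟩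
    y * 1#                 ≈⟨ *-identityʳ y ⟩
    y                      ∎
    where
    open ≈-Reasoning setoid
    x⁻¹ = proj₁ (#⇒invertible x#0)

  ·-monoʳ-≤ : ∀ n {x y} → x ≤ y → n · x ≤ n · y
  ·-monoʳ-≤ zero    x≤y = ≤-refl
  ·-monoʳ-≤ (suc n) x≤y = +-mono-≤ x≤y (·-monoʳ-≤ n x≤y)

  ·-nonneg-≤ : ∀ n {x} → 0# ≤ x → 0# ≤ n · x
  ·-nonneg-≤ zero    0≤x = ≤-refl
  ·-nonneg-≤ (suc n) 0≤x = +-nonneg 0≤x (·-nonneg-≤ n 0≤x)

  ·-zeroʳ : ∀ n → n · 0# ≈ 0#
  ·-zeroʳ zero    = refl
  ·-zeroʳ (suc n) = trans (+-identityˡ _) (·-zeroʳ n)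

  +-interchange : ∀ w x y z → (w + x) + (y + z) ≈ (w + y) + (x + z)
  +-interchange =
    solve 4 (λ w x y z → (w :+ x) :+ (y :+ z) := (w :+ y) :+ (x :+ z)) refl

  open CommutativeMonoidSum +-commutativeMonoid public using (∑-distrib-+; ∑-comm; sum-cong-≋)
  open SemiringSum semiring public using (*-distribˡ-sum)

  sum-0 : ∀ {n} (f : Fin n → Carrier) → (∀ i → f i ≈ 0#) → sum f ≈ 0#
  sum-0 {zero}  f f≈0 = refl
  sum-0 {suc n} f f≈0 = trans (+-cong (f≈0 zero) (sum-0 (f ∘ suc) (f≈0 ∘ suc))) (+-identityˡ 0#)

  ·-sum : ∀ n {k} (f : Fin k → Carrier) → n · sum f ≈ sum (λ i → n · f i)
  ·-sum n {zero}  f = ·-zeroʳ n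
  ·-sum n {suc k} f = trans (×-distrib-+ _ _ n) (+-congˡ (·-sum n (f ∘ suc)))

  sum-mono-≤ : ∀ {n} {f g : Fin n → Carrier} → (∀ i → f i ≤ g i) → sum f ≤ sum g
  sum-mono-≤ {zero}  f≤g = ≤-refl
  sum-mono-≤ {suc n} f≤g = +-mono-≤ (f≤g zero) (sum-mono-≤ (f≤g ∘ suc))

  sum-nonneg : ∀ {n} {f : Fin n → Carrier} → (∀ i → 0# ≤ f i) → 0# ≤ sum f
  sum-nonneg {zero}  0≤f = ≤-refl
  sum-nonneg {suc n} 0≤f = +-nonneg (0≤f zero) (sum-nonneg (0≤f ∘ suc))

  term≤sum : ∀ {n} {f : Fin n → Carrier} → (∀ i → 0# ≤ f i) → ∀ i → f i ≤ sum f
  term≤sum 0≤f zero    = x≤x+nonneg _ (sum-nonneg (0≤f ∘ suc))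
  term≤sum 0≤f (suc i) = ≤-trans (term≤sum (0≤f ∘ suc) i)
    (≤-trans (x≤x+nonneg _ (0≤f zero)) (≈⇒≤ (+-comm _ _)))

  infix 8 [_]_
  [_]_ : ∀ {p} {P : Set p} → Dec P → Carrier → Carrier
  [ yes _ ] x = x
  [ no _ ] x = 0#

  sum-[≟] : ∀ {n} (h : Fin n) (f : Fin n → Carrier) → sum (λ j → [ h ≟ j ] f j) ≈ f h
  sum-[≟] {suc n} zero f = trans (+-congˡ (sum-0 {n} _ λ j → refl)) (+-identityʳ (f zero))
  sum-[≟] (suc h)      f = trans (+-identityˡ _) (trans (sum-cong-≋ shift-[≟]) (sum-[≟] h (f ∘ suc)))
    where
    -- The decision for successors is obtained from the one for `h` and `j`, so both brackets reduce
    -- only after splitting on `h ≟ j`.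
    shift-[≟] : ∀ j → [ suc h ≟ suc j ] f (suc j) ≈ [ h ≟ j ] f (suc j)
    shift-[≟] j with h ≟ j
    ... | yes _ = refl
    ... | no _  = refl

  -- Sums over lists

  -- Written with `foldr` and `map` so that the numerator of `expectedMatched` is an instance by
  -- definition.
  ∑ : ∀ {a} {A : Set a} → (A → Carrier) → List A → Carrier
  ∑ f xs = foldr _+_ 0# (map f xs)

  module _ {a} {A : Set a} where

    ∑-++ : ∀ (f : A → Carrier) xs ys → ∑ f (xs ++ ys) ≈ ∑ f xs + ∑ f ys
    ∑-++ f []       ys = sym (+-identityˡ _)
    ∑-++ f (x ∷ xs) ys = trans (+-congˡ (∑-++ f xs ys)) (sym (+-assoc _ _ _))

    ∑-map : ∀ {b} {B : Set b} (f : A → Carrier) (g : B → A) xs → ∑ f (map g xs) ≡ ∑ (f ∘ g) xs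
    ∑-map f g xs = ≡.cong (foldr _+_ 0#) (≡.sym (map-∘ xs))

    ∑-concatMap : ∀ {b} {B : Set b} (f : A → Carrier) (g : B → List A) xs →
      ∑ f (concatMap g xs) ≈ ∑ (λ x → ∑ f (g x)) xs
    ∑-concatMap f g []       = refl
    ∑-concatMap f g (x ∷ xs) = trans (∑-++ f (g x) (concatMap g xs)) (+-congˡ (∑-concatMap f g xs))

    ∑-mono-≤ : ∀ {f g : A → Carrier} {xs} → All (λ x → f x ≤ g x) xs → ∑ f xs ≤ ∑ g xs
    ∑-mono-≤ []       = ≤-refl
    ∑-mono-≤ (p ∷ ps) = +-mono-≤ p (∑-mono-≤ ps)

    ∑-cong-All : ∀ {f g : A → Carrier} {xs} → All (λ x → f x ≈ g x) xs → ∑ f xs ≈ ∑ g xs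
    ∑-cong-All []       = refl
    ∑-cong-All (p ∷ ps) = +-cong p (∑-cong-All ps)

    ∑-cong : ∀ {f g : A → Carrier} xs → (∀ x → f x ≈ g x) → ∑ f xs ≈ ∑ g xs
    ∑-cong xs f≈g = ∑-cong-All (All.universal f≈g xs)

    ∑-+ : ∀ (f g : A → Carrier) xs → ∑ (λ x → f x + g x) xs ≈ ∑ f xs + ∑ g xs
    ∑-+ f g []       = sym (+-identityˡ 0#)
    ∑-+ f g (x ∷ xs) = trans (+-congˡ (∑-+ f g xs)) (+-interchange _ _ _ _)

    ∑-· : ∀ n (f : A → Carrier) xs → ∑ (λ x → n · f x) xs ≈ n · ∑ f xs
    ∑-· n f []       = sym (·-zeroʳ n)
    ∑-· n f (x ∷ xs) = trans (+-congˡ (∑-· n f xs)) (sym (×-distrib-+ _ _ n))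

    ∑-const : ∀ x (xs : List A) → ∑ (λ _ → x) xs ≈ length xs · x
    ∑-const x []       = refl
    ∑-const x (_ ∷ xs) = +-congˡ (∑-const x xs)

    ∑-nonneg : ∀ {f : A → Carrier} {xs} → All (λ x → 0# ≤ f x) xs → 0# ≤ ∑ f xs
    ∑-nonneg []       = ≤-refl
    ∑-nonneg (p ∷ ps) = +-nonneg p (∑-nonneg ps)

    sum-∑ : ∀ {n} (f : Fin n → A → Carrier) xs →
      sum (λ i → ∑ (f i) xs) ≈ ∑ (λ x → sum (λ i → f i x)) xs
    sum-∑ {n} f [] = sum-0 {n} (λ _ → 0#) (λ _ → refl)
    sum-∑     f (x ∷ xs) =
      trans (∑-distrib-+ (λ i → f i x) (λ i → ∑ (f i) xs)) (+-congˡ (sum-∑ f xs))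

  -- Sums over insertions and permutations.

  module _ {a} {A : Set a} where

    -- Both double sums visit the same lists. They are sorted by which of `x`, `y` stand before `z`;
    -- exchanging `x` and `y` permutes the classes, and induction treats the lists with both after
    -- `z`.
    ∑-insertions-comm : ∀ x y (f : List A → Carrier) zs →
      ∑ (λ ys → ∑ f (insertions x ys)) (insertions y zs) ≈
      ∑ (λ xs → ∑ f (insertions y xs)) (insertions x zs)
    ∑-insertions-comm x y f [] =
      solve 2 (λ a b → (a :+ (b :+ con 0)) :+ con 0 := (b :+ (a :+ con 0)) :+ con 0) refl _ _
    ∑-insertions-comm x y f (z ∷ zs) = begin
      ∑ F (insertions y (z ∷ zs))
        ≈⟨ expand x y ⟩
      (f (x ∷ y ∷ z ∷ zs) + (f (y ∷ x ∷ z ∷ zs) + side y x)) + (side x y + inner x y)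
        ≈⟨ solve 5 (λ a b c d e → (a :+ (b :+ c)) :+ (d :+ e) := (b :+ (a :+ d)) :+ (c :+ e)) refl
             _ _ _ _ _ ⟩
      (f (y ∷ x ∷ z ∷ zs) + (f (x ∷ y ∷ z ∷ zs) + side x y)) + (side y x + inner x y)
        ≈⟨ +-congˡ (+-congˡ (∑-insertions-comm x y (f ∘ (z ∷_)) zs)) ⟩
      (f (y ∷ x ∷ z ∷ zs) + (f (x ∷ y ∷ z ∷ zs) + side x y)) + (side y x + inner y x)
        ≈⟨ expand y x ⟨
      ∑ (λ xs → ∑ f (insertions y xs)) (insertions x (z ∷ zs)) ∎
      where
      open ≈-Reasoning setoid
      F = λ ys → ∑ f (insertions x ys)
      -- `side x y` has `x` before `z` and `y` after it; `inner` has both after `z`.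
      side inner : A → A → Carrier
      side x y = ∑ (λ ρ → f (x ∷ z ∷ ρ)) (insertions y zs)
      inner x y = ∑ (λ ρ → ∑ (f ∘ (z ∷_)) (insertions x ρ)) (insertions y zs)
      expand : ∀ x y → ∑ (λ ys → ∑ f (insertions x ys)) (insertions y (z ∷ zs)) ≈
        (f (x ∷ y ∷ z ∷ zs) + (f (y ∷ x ∷ z ∷ zs) + side y x)) + (side x y + inner x y)
      expand x y = +-cong
        (+-congˡ (+-congˡ (reflexive (≡.trans
          (∑-map f (y ∷_) (map (z ∷_) (insertions x zs)))
          (∑-map (f ∘ (y ∷_)) (z ∷_) (insertions x zs))))))
        (begin
          ∑ (λ ys → ∑ f (insertions x ys)) (map (z ∷_) (insertions y zs))
            ≡⟨ ∑-map (λ ys → ∑ f (insertions x ys)) (z ∷_) (insertions y zs) ⟩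
          ∑ (λ ρ → f (x ∷ z ∷ ρ) + ∑ f (map (z ∷_) (insertions x ρ))) (insertions y zs)
            ≈⟨ ∑-+ _ _ (insertions y zs) ⟩
          side x y + ∑ (λ ρ → ∑ f (map (z ∷_) (insertions x ρ))) (insertions y zs)
            ≈⟨ +-congˡ (∑-cong (insertions y zs) λ ρ →
                 reflexive (∑-map f (z ∷_) (insertions x ρ))) ⟩
          side x y + inner x y ∎)

    ∑-permutations-∷ : ∀ (f : List A → Carrier) x xs →
      ∑ f (permutations (x ∷ xs)) ≈ ∑ (λ ρ → ∑ f (insertions x ρ)) (permutations xs)
    ∑-permutations-∷ f x xs = ∑-concatMap f (insertions x) (permutations xs)

    -- Allows any chosen vertex to be moved to the front, so that a sum over all orders becomes a
    -- sum over its insertions into the orders of the others. The case of a swap is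
    -- `∑-insertions-comm`.
    ∑-permutations-↭ : ∀ {xs ys : List A} → xs ↭ ys → ∀ f →
      ∑ f (permutations xs) ≈ ∑ f (permutations ys)
    ∑-permutations-↭ ↭.refl f = refl
    ∑-permutations-↭ (prep {xs} {ys} x p) f = begin
      ∑ f (permutations (x ∷ xs))                        ≈⟨ ∑-permutations-∷ f x xs ⟩
      ∑ (λ ρ → ∑ f (insertions x ρ)) (permutations xs)   ≈⟨ ∑-permutations-↭ p _ ⟩
      ∑ (λ ρ → ∑ f (insertions x ρ)) (permutations ys)   ≈⟨ ∑-permutations-∷ f x ys ⟨
      ∑ f (permutations (x ∷ ys))                        ∎
      where open ≈-Reasoning setoid
    ∑-permutations-↭ (↭.swap {xs} {ys} x y p) f = begin
      ∑ f (permutations (x ∷ y ∷ xs))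
        ≈⟨ expand x y xs ⟩
      ∑ (λ ρ → ∑ (λ σ → ∑ f (insertions x σ)) (insertions y ρ)) (permutations xs)
        ≈⟨ ∑-cong (permutations xs) (∑-insertions-comm x y f) ⟩
      ∑ (λ ρ → ∑ (λ σ → ∑ f (insertions y σ)) (insertions x ρ)) (permutations xs)
        ≈⟨ ∑-permutations-↭ p _ ⟩
      ∑ (λ ρ → ∑ (λ σ → ∑ f (insertions y σ)) (insertions x ρ)) (permutations ys)
        ≈⟨ expand y x ys ⟨
      ∑ f (permutations (y ∷ x ∷ ys)) ∎
      where
      open ≈-Reasoning setoid
      expand : ∀ x y zs → ∑ f (permutations (x ∷ y ∷ zs)) ≈
        ∑ (λ ρ → ∑ (λ σ → ∑ f (insertions x σ)) (insertions y ρ)) (permutations zs)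
      expand x y zs = trans (∑-permutations-∷ f x (y ∷ zs))
        (∑-permutations-∷ (λ σ → ∑ f (insertions x σ)) y zs)
    ∑-permutations-↭ (↭.trans p q) f = trans (∑-permutations-↭ p f) (∑-permutations-↭ q f)

    ∑-const-permutations : ∀ x (xs : List A) → ∑ (λ _ → x) (permutations xs) ≈ (length xs !) · x
    ∑-const-permutations x []       = refl
    ∑-const-permutations x (y ∷ ys) = begin
      ∑ (λ _ → x) (permutations (y ∷ ys))
        ≈⟨ ∑-permutations-∷ (λ _ → x) y ys ⟩
      ∑ (λ ρ → ∑ (λ _ → x) (insertions y ρ)) (permutations ys)
        ≈⟨ ∑-cong-All (All.map (λ {ρ} ρ↭ys → trans (∑-const x (insertions y ρ))
             (×-congˡ (≡.trans (length-insertions y ρ) (≡.cong suc (↭-length ρ↭ys)))))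
             (permutations-↭ ys)) ⟩
      ∑ (λ _ → suc (length ys) · x) (permutations ys)
        ≈⟨ ∑-const-permutations _ ys ⟩
      (length ys !) · (suc (length ys) · x)
        ≈⟨ ×-assocˡ x (length ys !) (suc (length ys)) ⟩
      (length ys ! ℕ.* suc (length ys)) · x
        ≈⟨ ×-congˡ (ℕₚ.*-comm (length ys !) (suc (length ys))) ⟩
      (suc (length ys) !) · x ∎
      where open ≈-Reasoning setoid
  -- Weighted sums over the suffixes of a list.  When the last arrival comes
  -- first, the suffixes are the histories of the ordering.

  module _ {a} {A : Set a} where

    suffixSum : (ℕ → ℕ) → (List A → Carrier) → List A → Carrier
    suffixSum w f []       = w 0 · f []
    suffixSum w f (x ∷ xs) = w (suc (length xs)) · f (x ∷ xs) + suffixSum w f xs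

    -- A sum over the arrivals `x`, each with its history `xs` and weighted by the length of that
    -- history. The complete list precedes no arrival and has no term.
    stepSum : (ℕ → ℕ) → (A → List A → Carrier) → List A → Carrier
    stepSum w φ []       = 0#
    stepSum w φ (x ∷ xs) = w (length xs) · φ x xs + stepSum w φ xs

    module _ (w : ℕ → ℕ) where

      -- The predicate `P` passes to tails, so the inequality is needed only at suffixes that
      -- inherit an invariant such as being duplicate-free.
      suffixSum-mono-≤ : ∀ {p} {P : List A → Set p} → (∀ x xs → P (x ∷ xs) → P xs) →
        ∀ {f g} → (∀ xs → P xs → f xs ≤ g xs) → ∀ xs → P xs → suffixSum w f xs ≤ suffixSum w g xs
      suffixSum-mono-≤ tl f≤g []       p = ·-monoʳ-≤ (w 0) (f≤g [] p)
      suffixSum-mono-≤ tl f≤g (x ∷ xs) p = +-mono-≤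
        (·-monoʳ-≤ (w (suc (length xs))) (f≤g (x ∷ xs) p)) (suffixSum-mono-≤ tl f≤g xs (tl x xs p))

      suffixSum-+ : ∀ f g xs → suffixSum w (λ ρ → f ρ + g ρ) xs ≈ suffixSum w f xs + suffixSum w g xs
      suffixSum-+ f g []       = ×-distrib-+ _ _ (w 0)
      suffixSum-+ f g (x ∷ xs) =
        trans (+-cong (×-distrib-+ _ _ (w (suc (length xs)))) (suffixSum-+ f g xs)) (+-interchange _ _ _ _)

      suffixSum-cong : ∀ {f g} → (∀ ρ → f ρ ≈ g ρ) → ∀ xs → suffixSum w f xs ≈ suffixSum w g xs
      suffixSum-cong f≈g []       = ×-congʳ (w 0) (f≈g [])
      suffixSum-cong f≈g (x ∷ xs) = +-cong (×-congʳ (w (suc (length xs))) (f≈g (x ∷ xs))) (suffixSum-cong f≈g xs)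

      sum-suffixSum : ∀ {n} (f : Fin n → List A → Carrier) xs →
        sum (λ i → suffixSum w (f i) xs) ≈ suffixSum w (λ ρ → sum (λ i → f i ρ)) xs
      sum-suffixSum f []       = sym (·-sum (w 0) (λ i → f i []))
      sum-suffixSum f (x ∷ xs) = trans
        (∑-distrib-+ (λ i → w (suc (length xs)) · f i (x ∷ xs)) (λ i → suffixSum w (f i) xs))
        (+-cong (sym (·-sum (w (suc (length xs))) (λ i → f i (x ∷ xs)))) (sum-suffixSum f xs))

      stepSum-cong : ∀ {φ ψ} → (∀ x ρ → φ x ρ ≈ ψ x ρ) → ∀ xs → stepSum w φ xs ≈ stepSum w ψ xs
      stepSum-cong φ≈ψ []       = refl
      stepSum-cong φ≈ψ (x ∷ xs) = +-cong (×-congʳ (w (length xs)) (φ≈ψ x xs)) (stepSum-cong φ≈ψ xs)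

      sum-stepSum : ∀ {n} (φ : Fin n → A → List A → Carrier) xs →
        sum (λ j → stepSum w (φ j) xs) ≈ stepSum w (λ x ρ → sum (λ j → φ j x ρ)) xs
      sum-stepSum {n} φ [] = sum-0 {n} (λ _ → 0#) (λ _ → refl)
      sum-stepSum     φ (x ∷ xs) = trans
        (∑-distrib-+ (λ j → w (length xs) · φ j x xs) (λ j → stepSum w (φ j) xs))
        (+-cong (sym (·-sum (w (length xs)) (λ j → φ j x xs))) (sum-stepSum φ xs))

      stepSum-nonneg : ∀ {p} {P : List A → Set p} → (∀ x xs → P (x ∷ xs) → P xs) →
        ∀ {φ} → (∀ x xs → P (x ∷ xs) → 0# ≤ φ x xs) → ∀ xs → P xs → 0# ≤ stepSum w φ xs
      stepSum-nonneg tl 0≤φ []       p = ≤-refl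
      stepSum-nonneg tl 0≤φ (x ∷ xs) p = +-nonneg
        (·-nonneg-≤ (w (length xs)) (0≤φ x xs p)) (stepSum-nonneg tl 0≤φ xs (tl x xs p))

    -- The hockey-stick identity: by Pascal's rule the weights of all suffixes add up to one
    -- coefficient of the next order.
    suffixSum-const : ∀ m x (xs : List A) →
      suffixSum (multichoose m) (λ _ → x) xs ≈ multichoose (suc m) (length xs) · x
    suffixSum-const m x []       = ×-congˡ (multichoose-zero m)
    suffixSum-const m x (_ ∷ xs) = trans (+-congˡ (suffixSum-const m x xs))
      (sym (×-homo-+ x (multichoose m (suc (length xs))) _))

    -- Here `φ` is the increment of `g`, and by Pascal's rule `multichoose m` is the increment of
    -- `multichoose (suc m)`. The sum is therefore that of the increments of the product and
    -- telescopes.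
    summation-by-parts : ∀ m {g : List A → Carrier} {φ} →
      g [] ≈ 0# → (∀ x xs → g (x ∷ xs) ≈ g xs + φ x xs) → ∀ xs →
      stepSum (multichoose (suc m)) φ xs + suffixSum (multichoose m) g xs ≈
      multichoose (suc m) (length xs) · g xs
    summation-by-parts m {g} g[]≈0 g∷≈ [] = begin
      0# + multichoose m 0 · g []   ≈⟨ +-identityˡ _ ⟩
      multichoose m 0 · g []        ≈⟨ ×-congˡ (multichoose-zero m) ⟩
      1 · g []                      ∎
      where open ≈-Reasoning setoid
    summation-by-parts m {g} {φ} g[]≈0 g∷≈ (x ∷ xs) = begin
      (b · φ x xs + S) + (b′ · g (x ∷ xs) + W)
        ≈⟨ solve 4 (λ p s q w → (p :+ s) :+ (q :+ w) := q :+ ((s :+ w) :+ p)) refl _ _ _ _ ⟩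
      b′ · g (x ∷ xs) + ((S + W) + b · φ x xs)
        ≈⟨ +-congˡ (+-congʳ (summation-by-parts m g[]≈0 g∷≈ xs)) ⟩
      b′ · g (x ∷ xs) + (b · g xs + b · φ x xs)
        ≈⟨ +-congˡ (×-distrib-+ _ _ b) ⟨
      b′ · g (x ∷ xs) + b · (g xs + φ x xs)
        ≈⟨ +-congˡ (×-congʳ b (g∷≈ x xs)) ⟨
      b′ · g (x ∷ xs) + b · g (x ∷ xs)
        ≈⟨ ×-homo-+ _ b′ b ⟨
      multichoose (suc m) (suc (length xs)) · g (x ∷ xs) ∎
      where
      open ≈-Reasoning setoid
      b = multichoose (suc m) (length xs)
      b′ = multichoose m (suc (length xs))
      S = stepSum (multichoose (suc m)) φ xs
      W = suffixSum (multichoose m) g xs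

    -- The suffix of length k survives in 1 + |xs| - k of the insertions, and in
    -- 1 + k of them it occurs, extended by y, as the suffix of length 1 + k.  By
    -- multichoose-absorb the resulting weight
    -- (1 + |xs| - k) w k + (1 + k) w (1 + k) is the same multiple of w k for all k.
    suffixSum-insertions : ∀ m y {p} {P : List A → Set p} → (∀ x xs → P (x ∷ xs) → P xs) →
      ∀ {f} → (∀ xs → P xs → All (λ ρ → f xs ≤ f ρ) (insertions y xs)) → ∀ xs → P xs →
      suc (m ℕ.+ length xs) · suffixSum (multichoose m) f xs ≤
      ∑ (suffixSum (multichoose m) f) (insertions y xs)
    suffixSum-insertions m y tl {f} f-mono [] p = begin
      w₀ · f [] + (m ℕ.+ 0) · (w₀ · f [])
        ≈⟨ +-congˡ (×-assocˡ _ (m ℕ.+ 0) w₀) ⟩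
      w₀ · f [] + ((m ℕ.+ 0) ℕ.* w₀) · f []
        ≈⟨ +-congˡ (×-congˡ (≡.trans (≡.sym (multichoose-absorb m 0)) (ℕₚ.*-identityˡ w₁))) ⟩
      w₀ · f [] + w₁ · f []
        ≲⟨ +-monoʳ-≤ _ (·-monoʳ-≤ w₁ (All.head (f-mono [] p))) ⟩
      w₀ · f [] + w₁ · f (y ∷ [])
        ≈⟨ trans (+-comm _ _) (sym (+-identityʳ _)) ⟩
      w₁ · f (y ∷ []) + w₀ · f [] + 0# ∎
      where
      open ≤-Reasoning
      w₀ = multichoose m 0
      w₁ = multichoose m 1
    suffixSum-insertions m y tl {f} f-mono (x ∷ xs) p = begin
      suc (m ℕ.+ suc k) · (w′ · fx + S)
        ≈⟨ +-congˡ (×-distrib-+ _ _ (m ℕ.+ suc k)) ⟩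
      (w′ · fx + S) + ((m ℕ.+ suc k) · (w′ · fx) + (m ℕ.+ suc k) · S)
        -- One copy is the share of the suffixes of `x ∷ xs` in `y ∷ x ∷ xs`. Absorption turns the
        -- other `m + suc k` copies of `w′ · fx` into `2 + k` copies of `w · fx`, one for each
        -- insertion.
        ≈⟨ +-congˡ (+-cong
             (trans (×-assocˡ fx (m ℕ.+ suc k) w′)
               (trans (×-congˡ (≡.sym (multichoose-absorb m (suc k)))) (sym (×-assocˡ fx (2 ℕ.+ k) w))))
             (×-congˡ (ℕₚ.+-suc m k))) ⟩
      (w′ · fx + S) + ((w · fx + suc k · (w · fx)) + suc (m ℕ.+ k) · S)
        ≈⟨ solve 4 (λ u a b c → u :+ ((a :+ b) :+ c) := (a :+ u) :+ (b :+ c)) refl _ _ _ _ ⟩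
      (w · fx + (w′ · fx + S)) + (suc k · (w · fx) + suc (m ℕ.+ k) · S)
        ≲⟨ +-mono-≤
             (+-monoˡ-≤ _ (·-monoʳ-≤ w (All.head (f-mono (x ∷ xs) p))))
             (+-mono-≤ front (suffixSum-insertions m y tl f-mono xs (tl x xs p))) ⟩
      (w · f (y ∷ x ∷ xs) + (w′ · fx + S)) + (∑ front-term ρs + ∑ (suffixSum (multichoose m) f) ρs)
        ≈⟨ +-congˡ (∑-+ front-term (suffixSum (multichoose m) f) ρs) ⟨
      (w · f (y ∷ x ∷ xs) + (w′ · fx + S)) + ∑ (suffixSum (multichoose m) f ∘ (x ∷_)) ρs
        ≡⟨ ≡.cong (w · f (y ∷ x ∷ xs) + (w′ · fx + S) +_)
             (∑-map (suffixSum (multichoose m) f) (x ∷_) ρs) ⟨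
      ∑ (suffixSum (multichoose m) f) (insertions y (x ∷ xs)) ∎
      where
      open ≤-Reasoning
      k = length xs
      w = multichoose m (2 ℕ.+ k)
      w′ = multichoose m (suc k)
      fx = f (x ∷ xs)
      S = suffixSum (multichoose m) f xs
      ρs = insertions y xs
      front-term = λ ρ → multichoose m (suc (length ρ)) · f (x ∷ ρ)
      -- The insertions that keep `x` in front: there are `suc k` of them, and each contributes its
      -- full list.
      front : suc k · (w · fx) ≤ ∑ front-term ρs
      front = begin
        suc k · (w · fx)
          ≈⟨ ×-congˡ (length-insertions y xs) ⟨
        length ρs · (w · fx)
          ≈⟨ ∑-const (w · fx) ρs ⟨
        ∑ (λ _ → w · fx) ρs
          ≲⟨ ∑-mono-≤ (All.zipWith (λ (ρ↭ , fx≤) → ≤-trans (·-monoʳ-≤ w fx≤)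
               (≈⇒≤ (×-congˡ (≡.cong (multichoose m ∘ suc) (≡.sym (↭-length ρ↭))))))
               (insertions-↭ y xs , All.map⁻ (All.tail (f-mono (x ∷ xs) p)))) ⟩
        ∑ front-term ρs ∎

  -- The step at which a given vertex arrives.

  module _ {n : ℕ} where

    at : Fin n → (List (Fin n) → Carrier) → Fin n → List (Fin n) → Carrier
    at j f h ρ = [ h ≟ j ] f ρ

    module _ (w : ℕ → ℕ) (j : Fin n) (f : List (Fin n) → Carrier) where

      at-≢ : ∀ {h} → j ≢ h → ∀ ρ → at j f h ρ ≈ 0#
      at-≢ {h} j≢h ρ with h ≟ j
      ... | yes h≡j = ⊥-elim (j≢h (≡.sym h≡j))
      ... | no _    = refl

      at-refl : ∀ ρ → at j f j ρ ≈ f ρ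
      at-refl ρ with j ≟ j
      ... | yes _  = refl
      ... | no j≢j = ⊥-elim (j≢j ≡.refl)

      stepSum-at-∉ : ∀ {xs} → All (j ≢_) xs → stepSum w (at j f) xs ≈ 0#
      stepSum-at-∉ []           = refl
      stepSum-at-∉ {x ∷ xs} (j≢x ∷ j∉) = trans
        (+-cong (trans (×-congʳ (w (length xs)) (at-≢ j≢x xs)) (·-zeroʳ (w (length xs)))) (stepSum-at-∉ j∉))
        (+-identityˡ 0#)

      stepSum-at-head : ∀ xs → All (j ≢_) xs → stepSum w (at j f) (j ∷ xs) ≈ w (length xs) · f xs
      stepSum-at-head xs j∉ =
        trans (+-cong (×-congʳ (w (length xs)) (at-refl xs)) (stepSum-at-∉ j∉)) (+-identityʳ _)

      -- As `j` runs through all positions, every suffix of `xs` is the history of `j` exactly once.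
      stepSum-at-insertions : ∀ {xs} → All (j ≢_) xs →
        ∑ (stepSum w (at j f)) (insertions j xs) ≈ suffixSum w f xs
      stepSum-at-insertions [] = trans (+-identityʳ _) (stepSum-at-head [] [])
      stepSum-at-insertions {x ∷ xs} j∉@(j≢x ∷ j∉xs) = +-cong (stepSum-at-head (x ∷ xs) j∉) (begin
        ∑ (stepSum w (at j f)) (map (x ∷_) (insertions j xs))
          ≡⟨ ∑-map (stepSum w (at j f)) (x ∷_) (insertions j xs) ⟩
        ∑ (λ ρ → w (length ρ) · at j f x ρ + stepSum w (at j f) ρ) (insertions j xs)
          ≈⟨ ∑-cong (insertions j xs) (λ ρ → trans
               (+-congʳ (trans (×-congʳ (w (length ρ)) (at-≢ j≢x ρ)) (·-zeroʳ (w (length ρ)))))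
               (+-identityˡ _)) ⟩
        ∑ (stepSum w (at j f)) (insertions j xs)
          ≈⟨ stepSum-at-insertions j∉xs ⟩
        suffixSum w f xs ∎)
        where open ≈-Reasoning setoid

  -- Passing from the partial sums of the exponential series to e

  -- The normalisation under which the total weight `multichoose (suc m) n` becomes 1/m!, the term
  -- of the exponential series.
  [n!]/[n+m]! : ℕ → ℕ → Carrier
  [n!]/[n+m]! n m = (n !) · (1/! (n ℕ.+ m))

  multichoose·[n!]/[n+m]! : ∀ n m → multichoose (suc m) n · [n!]/[n+m]! n m ≈ 1/! m
  multichoose·[n!]/[n+m]! n m = begin
    b · ((n !) · u)
      ≈⟨ ×-assocˡ u b (n !) ⟩
    (b ℕ.* n !) · u
      ≈⟨ *-identityˡ _ ⟨
    1# * ((b ℕ.* n !) · u)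
      ≈⟨ *-congʳ (x*1/x≈1 (!·1#0 m)) ⟨
    ((m !) · 1#) * (1/! m) * ((b ℕ.* n !) · u)
      ≈⟨ solve 3 (λ x y z → x :* y :* z := y :* (x :* z)) refl _ _ _ ⟩
    (1/! m) * (((m !) · 1#) * ((b ℕ.* n !) · u))
      ≈⟨ *-congˡ (trans (·1-* (m !) _) (×-assocˡ u (m !) (b ℕ.* n !))) ⟩
    (1/! m) * ((m ! ℕ.* (b ℕ.* n !)) · u)
      ≈⟨ *-congˡ (×-congˡ (≡.trans (ℕₚ.*-comm (m !) _) (multichoose-! m n))) ⟩
    (1/! m) * (((n ℕ.+ m) !) · u)
      ≈⟨ *-congˡ (trans (sym (·1-* ((n ℕ.+ m) !) u)) (x*1/x≈1 (!·1#0 (n ℕ.+ m)))) ⟩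
    (1/! m) * 1#
      ≈⟨ *-identityʳ _ ⟩
    1/! m ∎
    where
    open ≈-Reasoning setoid
    b = multichoose (suc m) n
    u = 1/! (n ℕ.+ m)

  [n!]/[n+m]!-suc : ∀ n m → suc (m ℕ.+ n) · [n!]/[n+m]! n (suc m) ≈ [n!]/[n+m]! n m
  [n!]/[n+m]!-suc n m = begin
    suc (m ℕ.+ n) · ((n !) · (1/! (n ℕ.+ suc m)))
      ≡⟨ ≡.cong₂ (λ i j → suc i · ((n !) · (1/! j))) (ℕₚ.+-comm m n) (ℕₚ.+-suc n m) ⟩
    suc (n ℕ.+ m) · ((n !) · u)
      ≈⟨ ×-assocˡ u (suc (n ℕ.+ m)) (n !) ⟩
    (suc (n ℕ.+ m) ℕ.* n !) · u
      ≈⟨ ×-congˡ (ℕₚ.*-comm (suc (n ℕ.+ m)) (n !)) ⟩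
    (n ! ℕ.* suc (n ℕ.+ m)) · u
      ≈⟨ ×-assocˡ u (n !) (suc (n ℕ.+ m)) ⟨
    (n !) · (suc (n ℕ.+ m) · u)
      ≈⟨ ×-congʳ (n !) (1/!-suc (n ℕ.+ m)) ⟨
    [n!]/[n+m]! n m ∎
    where
    open ≈-Reasoning setoid
    u = 1/! suc (n ℕ.+ m)

  [n!]/[n+m]!-nonneg : ∀ n m → 0# ≤ [n!]/[n+m]! n m
  [n!]/[n+m]!-nonneg n m = ·-nonneg (n !) (1/!-pos (n ℕ.+ m))

  -- Let F(t) be the total expected amount matched by time t when the n
  -- vertices arrive at independent uniform times in [0,1].  Up to a factor
  -- depending on m, D (suc m) is ∫ t^m F, and the recurrence is a ≤ F + F′
  -- integrated against t^m, by parts.  Divided by m! it telescopes.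
  module _ (n : ℕ) {a u : Carrier} (D : ℕ → Carrier) (D₀-nonneg : 0# ≤ D 0)
    (D-bound : ∀ m → D m ≤ multichoose (suc m) n · u)
    (D-recurrence : ∀ m →
      (n ! ℕ.* multichoose (2 ℕ.+ m) n) · a + suc (m ℕ.+ n) · D m ≤
      D (suc m) + (suc (m ℕ.+ n) ℕ.* multichoose (suc m) n) · u)
    where

    private
      v : ℕ → Carrier
      v = [n!]/[n+m]! n
      a! : Carrier
      a! = (n !) · a

    -- The recurrence times `v (suc m)`. The factor `suc (m + n)` turns `v (suc m)` into `v m`, so
    -- that `D m` and `D (suc m)` each carry their own normalisation.
    scaled-recurrence : ∀ m → (1/! suc m) * a! + v m * D m ≤ v (suc m) * D (suc m) + (1/! m) * u
    scaled-recurrence m = begin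
      (1/! suc m) * a! + v m * D m
        ≈⟨ +-cong (*-congʳ (multichoose·[n!]/[n+m]! n (suc m))) (*-congʳ ([n!]/[n+m]!-suc n m)) ⟨
      (b′ · v′) * a! + (K · v′) * D m
        ≈⟨ +-cong (slide b′ a!) (slide K (D m)) ⟩
      v′ * (b′ · a!) + v′ * (K · D m)
        ≈⟨ distribˡ v′ _ _ ⟨
      v′ * (b′ · a! + K · D m)
        ≈⟨ *-congˡ (+-congʳ (trans (×-assocˡ a b′ (n !)) (×-congˡ (ℕₚ.*-comm b′ (n !))))) ⟩
      v′ * ((n ! ℕ.* b′) · a + K · D m)
        ≲⟨ *-monoʳ-≤-nonneg ([n!]/[n+m]!-nonneg n (suc m)) (D-recurrence m) ⟩
      v′ * (D (suc m) + (K ℕ.* b) · u)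
        ≈⟨ distribˡ v′ _ _ ⟩
      v′ * D (suc m) + v′ * ((K ℕ.* b) · u)
        ≈⟨ +-congˡ (slide (K ℕ.* b) u) ⟨
      v′ * D (suc m) + ((K ℕ.* b) · v′) * u
        ≈⟨ +-congˡ (*-congʳ (trans (×-congˡ (ℕₚ.*-comm K b)) (sym (×-assocˡ v′ b K)))) ⟩
      v′ * D (suc m) + (b · (K · v′)) * u
        ≈⟨ +-congˡ (*-congʳ (trans (×-congʳ b ([n!]/[n+m]!-suc n m)) (multichoose·[n!]/[n+m]! n m))) ⟩
      v′ * D (suc m) + (1/! m) * u ∎
      where
      open ≤-Reasoning
      K = suc (m ℕ.+ n)
      b = multichoose (suc m) n
      b′ = multichoose (2 ℕ.+ m) n
      v′ = v (suc m)
      slide : ∀ k x → (k · v′) * x ≈ v′ * (k · x)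
      slide k x = trans (×-assoc-* k v′ x) (sym (×-comm-* k v′ x))

    -- Adds up `scaled-recurrence`. It supplies the series on the left from index 1 on; the term
    -- 1/0! is paid for by the summand `a!`.
    telescoped : ∀ m → a! * ∑1/! (suc m) ≤ a! + (v m * D m + u * ∑1/! m)
    telescoped zero = begin
      a! * (0# + (1/! 0))      ≈⟨ *-congˡ (trans (+-identityˡ _) 1/!0≈1) ⟩
      a! * 1#                  ≈⟨ *-identityʳ a! ⟩
      a!                       ≲⟨ x≤x+nonneg a! (+-nonneg
                                    (*-nonneg ([n!]/[n+m]!-nonneg n 0) D₀-nonneg)
                                    (≈⇒≤ (sym (zeroʳ u)))) ⟩
      a! + (v 0 * D 0 + u * 0#) ∎
      where
      open ≤-Reasoning
      1/!0≈1 : 1/! 0 ≈ 1#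
      1/!0≈1 = trans (sym (*-identityˡ _))
        (trans (*-congʳ (sym (+-identityʳ 1#))) (x*1/x≈1 (!·1#0 0)))
    telescoped (suc m) = begin
      a! * (∑1/! (suc m) + (1/! suc m))
        ≈⟨ trans (distribˡ a! _ _) (+-congˡ (*-comm a! _)) ⟩
      a! * ∑1/! (suc m) + (1/! suc m) * a!
        ≲⟨ +-monoˡ-≤ _ (telescoped m) ⟩
      a! + (v m * D m + u * ∑1/! m) + (1/! suc m) * a!
        ≈⟨ solve 4 (λ a x y z → a :+ (x :+ y) :+ z := (z :+ x) :+ (a :+ y)) refl _ _ _ _ ⟩
      (1/! suc m) * a! + v m * D m + (a! + u * ∑1/! m)
        ≲⟨ +-monoˡ-≤ _ (scaled-recurrence m) ⟩
      v (suc m) * D (suc m) + (1/! m) * u + (a! + u * ∑1/! m)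
        ≈⟨ solve 5 (λ x f u a s → x :+ f :* u :+ (a :+ u :* s) := a :+ (x :+ u :* (s :+ f))) refl
             _ _ _ _ _ ⟩
      a! + (v (suc m) * D (suc m) + u * ∑1/! (suc m)) ∎
      where open ≤-Reasoning

    -- After normalisation `D-bound` replaces the remaining `D m` by u/m!, exactly the term missing
    -- from the partial sum on the right.
    partial-sum-bound : ∀ m → a! * ∑1/! (suc m) ≤ a! + u * ∑1/! (suc m)
    partial-sum-bound m = begin
      a! * ∑1/! (suc m)
        ≲⟨ telescoped m ⟩
      a! + (v m * D m + u * ∑1/! m)
        ≲⟨ +-monoʳ-≤ a! (+-monoˡ-≤ _
             (*-monoʳ-≤-nonneg ([n!]/[n+m]!-nonneg n m) (D-bound m))) ⟩
      a! + (v m * (b · u) + u * ∑1/! m)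
        ≈⟨ +-congˡ (+-congʳ (trans (×-comm-* b (v m) u) (sym (×-assoc-* b (v m) u)))) ⟩
      a! + ((b · v m) * u + u * ∑1/! m)
        ≈⟨ +-congˡ (+-congʳ (*-congʳ (multichoose·[n!]/[n+m]! n m))) ⟩
      a! + ((1/! m) * u + u * ∑1/! m)
        ≈⟨ +-congˡ (solve 3 (λ f u s → f :* u :+ u :* s := u :* (s :+ f)) refl _ _ _) ⟩
      a! + u * ∑1/! (suc m) ∎
      where
      open ≤-Reasoning
      b = multichoose (suc m) n

  -- If a + u e < a e, then a / (a - u) < e, so that a partial sum of the
  -- series exceeds a / (a - u).
  bound-at-e : ∀ {a u} → 0# ≤ a → (∀ m → a * ∑1/! (suc m) ≤ a + u * ∑1/! (suc m)) →
    a * e ≤ a + u * e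
  bound-at-e {a} {u} 0≤a bound a+ue<ae = bound k a+uS<aS
    where
    d t : Carrier
    a<de : a < e * (a - u)
    d = a - u
    d+u≈a : d + u ≈ a
    d+u≈a = x-y+y≈x a u
    a*≈ : ∀ x → a * x ≈ d * x + u * x
    a*≈ x = trans (*-congʳ (sym d+u≈a)) (distribʳ x d u)
    +-cancelʳ-< : ∀ {x y} z → x + z < y + z → x < y
    +-cancelʳ-< {x} {y} z = <-cong (x+y-y≈x x z) (x+y-y≈x y z) ∘ +-monoˡ-< (- z)
    a<de = +-cancelʳ-< (u * e) (<-cong refl (trans (a*≈ e) (+-congʳ (*-comm d e))) a+ue<ae)
    0<d : 0# < d
    0<d = *-cancelˡ-< 0<e (<-cong (sym (zeroʳ e)) refl (≤-<-trans 0≤a a<de))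
    t = a / d [ >⇒#0 0<d ]
    dt≈a : d * t ≈ a
    dt≈a = *-/ a (>⇒#0 0<d)
    t<e : t < e
    t<e = *-cancelˡ-< 0<d (<-cong (sym dt≈a) (*-comm e d) a<de)
    0<e-t : 0# < e - t
    0<e-t = <-cong (-‿inverseʳ t) refl (+-monoˡ-< (- t) t<e)
    -- With tolerance `e - t`, the late partial sums exceed `t`. The index `suc k` below matches the
    -- form of `bound`.
    near : ∃ λ k → ∀ n → k ℕ.≤ n → (∑1/! n - e < e - t) × (e - ∑1/! n < e - t)
    near = ∑1/!⟶e (e - t) 0<e-t
    k : ℕ
    k = proj₁ near
    S : Carrier
    S = ∑1/! (suc k)
    t<S : t < S
    t<S = +-cancelʳ-< e (<-cong
      (trans (solve 4 (λ e s t s′ → (e :+ s) :+ (t :+ s′) := (t :+ e) :+ (s :+ s′)) refl e (- S) t S)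
        (trans (+-congˡ (-‿inverseˡ S)) (+-identityʳ _)))
      (trans (solve 4 (λ e s t s′ → (e :+ s) :+ (s′ :+ t) := (t :+ e) :+ (s :+ s′)) refl e (- t) S t)
        (trans (+-congˡ (-‿inverseˡ t)) (+-identityʳ _)))
      (+-monoˡ-< (t + S) (proj₂ (proj₂ near (suc k) (ℕₚ.n≤1+n k)))))
    a+uS<aS : a + u * S < a * S
    a+uS<aS = <-cong (+-congʳ dt≈a) (sym (a*≈ S)) (+-monoˡ-< (u * S) (*-monoʳ-< 0<d t<S))

-- Fractional matchings and online algorithms

module _ {c ℓ₁ ℓ₂} (ℝ : RealNumbers c ℓ₁ ℓ₂) where
  open RealArithmetic ℝ hiding (zero)
  open OnlineMatching ℝ
  open OrderedField ℝ

  -- Linear programming duality.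

  module _ {V : Set} {l : ℕ} (G : BipartiteGraph V l) where
    open BipartiteGraph G

    -- Each edge value is charged to its two ends and the charges are regrouped by vertex, where the
    -- load is at most 1. The scale `k` admits integer-weighted dual solutions without division.
    weak-duality : ∀ {x} → IsFractionalMatching G x →
      ∀ k (b : Fin l → Carrier) (a : Fin r → Carrier) →
      (∀ i → 0# ≤ b i) → (∀ j → 0# ≤ a j) → (∀ i j → i ∈ nbhd j → k ≤ b i + a j) →
      k * value G x ≤ sum b + sum a
    weak-duality {x} M k b a 0≤b 0≤a k≤ = begin
      k * value G x
        ≈⟨ *-distribˡ-sum k (λ i → sum (x i)) ⟩
      sum (λ i → k * sum (x i))
        ≈⟨ sum-cong-≋ (λ i → *-distribˡ-sum k (x i)) ⟩
      sum (λ i → sum (λ j → k * x i j))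
        ≲⟨ sum-mono-≤ (λ i → sum-mono-≤ (λ j → edge i j)) ⟩
      sum (λ i → sum (λ j → b i * x i j + a j * x i j))
        ≈⟨ sum-cong-≋ (λ i → ∑-distrib-+ (λ j → b i * x i j) (λ j → a j * x i j)) ⟩
      sum (λ i → sum (λ j → b i * x i j) + sum (λ j → a j * x i j))
        ≈⟨ ∑-distrib-+ (λ i → sum (λ j → b i * x i j)) (λ i → sum (λ j → a j * x i j)) ⟩
      sum (λ i → sum (λ j → b i * x i j)) + sum (λ i → sum (λ j → a j * x i j))
        ≈⟨ +-congˡ (∑-comm (λ i j → a j * x i j)) ⟩
      sum (λ i → sum (λ j → b i * x i j)) + sum (λ j → sum (λ i → a j * x i j))
        ≲⟨ +-mono-≤ (sum-mono-≤ (λ i → load (0≤b i) (x i) (offline i)))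
                    (sum-mono-≤ (λ j → load (0≤a j) (λ i → x i j) (online j))) ⟩
      sum b + sum a ∎
      where
      open ≤-Reasoning
      open IsFractionalMatching M
      edge : ∀ i j → k * x i j ≤ b i * x i j + a j * x i j
      edge i j with i ∈? nbhd j
      ... | yes i∈N = ≤-trans (*-monoˡ-≤-nonneg (nonneg i j) (k≤ i j i∈N)) (≈⇒≤ (distribʳ _ _ _))
      ... | no i∉N  = ≤-trans (≈⇒≤ (trans (*-congˡ (support i j i∉N)) (zeroʳ k)))
        (+-nonneg (*-nonneg (0≤b i) (nonneg i j)) (*-nonneg (0≤a j) (nonneg i j)))
      load : ∀ {n w} → 0# ≤ w → (y : Fin n → Carrier) → sum y ≤ 1# → sum (λ i → w * y i) ≤ w
      load {w = w} 0≤w y y≤1 = ≤-trans (≈⇒≤ (sym (*-distribˡ-sum w y)))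
        (≤-trans (*-monoʳ-≤-nonneg 0≤w y≤1) (≈⇒≤ (*-identityʳ w)))

  -- Water-levels and gains along a history.

  module RandomOrder {V : Set} {l : ℕ} (A : OnlineAlgorithm V l)
    (greedy : Greedy A) (allocation-monotone : AllocationMonotone A) (G : BipartiteGraph V l) where
    open OnlineAlgorithm A
    open BipartiteGraph G

    seq : List (Fin r) → Sequence V l
    seq = map vertex

    level : Fin l → List (Fin r) → Carrier
    level i ρ = waterLevel (seq ρ) i

    gain : Fin r → List (Fin r) → Carrier
    gain j ρ = sum (x (seq ρ) (vertex j))

    total : List (Fin r) → Carrier
    total ρ = matched A (seq ρ)

    seq-input : ∀ {ρ} → Unique ρ → IsInput (seq ρ)
    seq-input {ρ} ρ! = ≡.subst Unique (map-∘ ρ) (Unique.map⁺ label-inj ρ!)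

    Unique-resp : ∀ {ρ σ : List (Fin r)} → ρ ↭ σ → Unique ρ → Unique σ
    Unique-resp p = Unique-resp-↭ (≡.setoid (Fin r)) (↭⇒↭ₛ p)

    Unique-tail : ∀ j (ρ : List (Fin r)) → Unique (j ∷ ρ) → Unique ρ
    Unique-tail j ρ = tail

    Fresh : Fin r → List (Fin r) → Set
    Fresh j ρ = Unique (j ∷ ρ)

    Fresh-tail : ∀ {j} h ρ → Fresh j (h ∷ ρ) → Fresh j ρ
    Fresh-tail h ρ ((_ ∷ j∉) ∷ _ ∷ ρ!) = j∉ ∷ ρ!

    level-∷ : ∀ {j ρ} → Fresh j ρ → ∀ i → level i ρ ≤ level i (j ∷ ρ)
    level-∷ jρ! i = x≤x+nonneg _ (nonneg _ _ (seq-input jρ!) i)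

    level-nonneg : ∀ {ρ} → Unique ρ → ∀ i → 0# ≤ level i ρ
    level-nonneg {[]}    ρ! i = ≤-refl
    level-nonneg {j ∷ ρ} ρ! i = ≤-trans (level-nonneg (tail ρ!) i) (level-∷ ρ! i)

    gain-nonneg : ∀ j ρ → Fresh j ρ → 0# ≤ gain j ρ
    gain-nonneg j ρ jρ! = sum-nonneg (nonneg _ _ (seq-input jρ!))

    total-nonneg : ∀ {ρ} → Unique ρ → 0# ≤ total ρ
    total-nonneg {[]}    ρ! = ≤-refl
    total-nonneg {j ∷ ρ} ρ! = +-nonneg (total-nonneg (tail ρ!)) (gain-nonneg j ρ ρ!)

    -- The same allocations, counted by offline vertices and by arrivals.
    sum-level : ∀ ρ → sum (λ i → level i ρ) ≈ total ρ
    sum-level []      = sum-0 {l} (λ _ → 0#) (λ _ → refl)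
    sum-level (j ∷ ρ) = trans
      (∑-distrib-+ (λ i → level i ρ) (x (seq ρ) (vertex j))) (+-congʳ (sum-level ρ))

    -- If `j` is inserted as the latest arrival, its allocations only add. If it comes earlier,
    -- induction compares the levels before `h` arrives, and allocation-monotonicity carries the
    -- comparison past `h`.
    level-insertions : ∀ j ρ → Fresh j ρ → All (λ π → ∀ i → level i ρ ≤ level i π) (insertions j ρ)
    level-insertions j []      jρ! = level-∷ jρ! ∷ []
    level-insertions j (h ∷ ρ) jρ! = level-∷ jρ! ∷ All.map⁺ (All.zipWith
      (λ {π} (π↭jρ , ρ≤π) → allocation-monotone (seq ρ) (seq π) (vertex h)
        (seq-input (tail jρ!))
        (seq-input (Unique-resp (↭-trans (↭.swap j h ↭-refl) (prep h (↭-sym π↭jρ))) jρ!))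
        ρ≤π)
      (insertions-↭ j ρ , level-insertions j ρ (Fresh-tail h ρ jρ!)))

    -- Either the gain is 1, or `i` ends at level 1 and its increase is one summand of the gain. As
    -- `≤` is a negation, the double negation in `Greedy` can be discharged.
    greedy-edge : ∀ {i j ρ} → i ∈ nbhd j → Fresh j ρ → 1# ≤ level i ρ + gain j ρ
    greedy-edge {i} {j} {ρ} i∈N jρ! level+gain<1 = greedy (seq ρ) (vertex j) jρ!ᵢ
      [ (λ gain≈1 → ≤-trans (≈⇒≤ (sym gain≈1)) gain≤ level+gain<1)
      , (λ full → ≤-trans (≈⇒≤ (sym (full i i∈N)))
                    (+-monoʳ-≤ _ (term≤sum (nonneg _ _ jρ!ᵢ) i)) level+gain<1)
      ]′
      where
      jρ!ᵢ = seq-input jρ!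
      gain≤ : gain j ρ ≤ level i ρ + gain j ρ
      gain≤ = ≤-trans (x≤x+nonneg _ (level-nonneg (tail jρ!) i)) (≈⇒≤ (+-comm _ _))

    -- Sums over all arrival orders.

    orders : List (List (Fin r))
    orders = permutations (allFin r)

    orders-Unique : All Unique orders
    orders-Unique =
      All.map (λ p → Unique-resp (↭-sym p) (Unique.allFin⁺ r)) (permutations-↭ (allFin r))

    length-allFin : length (allFin r) ≡ r
    length-allFin = length-tabulate id

    orders-length : All (λ π → length π ≡ r) orders
    orders-length = All.map (λ p → ≡.trans (↭-length p) length-allFin) (permutations-↭ (allFin r))

    allMatched : Carrier
    allMatched = ∑ total orders

    -- The sequence `D` of the abstract recurrence. At 0 only the empty history has weight.
    historyMatched : ℕ → Carrier
    historyMatched m = ∑ (suffixSum (multichoose m) total) orders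

    historyMatched-nonneg : ∀ m → 0# ≤ historyMatched m
    historyMatched-nonneg m = ∑-nonneg (All.map (λ {π} π! →
      ≤-trans
        (≈⇒≤ (sym (trans (suffixSum-const m 0# π) (·-zeroʳ (multichoose (suc m) (length π))))))
        (suffixSum-mono-≤ (multichoose m) Unique-tail (λ _ → total-nonneg) π π!)) orders-Unique)

    historyMatched-≤ : ∀ m → historyMatched m ≤ multichoose (suc m) r · allMatched
    historyMatched-≤ m = ≤-trans (∑-mono-≤ (All.zipWith weighted-≤ (orders-Unique , orders-length)))
      (≈⇒≤ (∑-· (multichoose (suc m) r) total orders))
      where
      weighted-≤ : ∀ {π} → Unique π × length π ≡ r →
        suffixSum (multichoose m) total π ≤ multichoose (suc m) r · total π
      weighted-≤ {π} (π! , |π|≡r) = ≤-trans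
        -- The invariant carries the bound by `total π` from the whole order down to its histories,
        -- since gains are nonnegative.
        (suffixSum-mono-≤ (multichoose m) {P = λ ρ → Unique ρ × total ρ ≤ total π}
          (λ { j ρ (ρ! , ≤π) → tail ρ! , ≤-trans (x≤x+nonneg _ (gain-nonneg j ρ ρ!)) ≤π })
          (λ _ → proj₂) π (π! , ≤-refl))
        (≈⇒≤ (trans (suffixSum-const m (total π) π)
          (×-congˡ (≡.cong (multichoose (suc m)) |π|≡r))))

    -- The dual solution: weighted sums of levels and gains.

    offlineDual : ℕ → Fin l → Carrier
    offlineDual m i = ∑ (suffixSum (multichoose (suc m)) (level i)) orders

    onlineDual : ℕ → Fin r → Carrier
    onlineDual m j = ∑ (stepSum (multichoose (suc m)) (at j (gain j))) orders

    offlineDual-nonneg : ∀ m i → 0# ≤ offlineDual m i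
    offlineDual-nonneg m i = ∑-nonneg (All.map (λ {π} π! →
      ≤-trans
        (≈⇒≤ (sym (trans (suffixSum-const (suc m) 0# π) (·-zeroʳ (multichoose (2 ℕ.+ m) (length π))))))
        (suffixSum-mono-≤ (multichoose (suc m)) Unique-tail (λ _ ρ! → level-nonneg ρ! i) π π!))
      orders-Unique)

    onlineDual-nonneg : ∀ m j → 0# ≤ onlineDual m j
    onlineDual-nonneg m j = ∑-nonneg (All.map
      (stepSum-nonneg (multichoose (suc m)) Unique-tail at-nonneg _) orders-Unique)
      where
      at-nonneg : ∀ h ρ → Fresh h ρ → 0# ≤ at j (gain j) h ρ
      at-nonneg h ρ hρ! with h ≟ j
      ... | yes ≡.refl = gain-nonneg h ρ hρ!
      ... | no _       = ≤-refl

    sum-offlineDual : ∀ m → sum (offlineDual m) ≈ historyMatched (suc m)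
    sum-offlineDual m = begin
      sum (offlineDual m)
        ≈⟨ sum-∑ (λ i → suffixSum w (level i)) orders ⟩
      ∑ (λ π → sum (λ i → suffixSum w (level i) π)) orders
        ≈⟨ ∑-cong orders (λ π → trans (sum-suffixSum w level π) (suffixSum-cong w sum-level π)) ⟩
      historyMatched (suc m) ∎
      where
      open ≈-Reasoning setoid
      w = multichoose (suc m)

    -- Over all `j` the brackets collapse to the gain of the actual arrival. Gains are the
    -- increments of `total`, so summation by parts applies: the discrete form of integrating t^m
    -- F′(t).
    sum-onlineDual : ∀ m →
      sum (onlineDual m) + historyMatched m ≈ multichoose (suc m) r · allMatched
    sum-onlineDual m = begin
      sum (onlineDual m) + historyMatched m
        ≈⟨ +-congʳ (sum-∑ (λ j → stepSum w (at j (gain j))) orders) ⟩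
      ∑ (λ π → sum (λ j → stepSum w (at j (gain j)) π)) orders + historyMatched m
        ≈⟨ ∑-+ _ _ orders ⟨
      ∑ (λ π → sum (λ j → stepSum w (at j (gain j)) π) + suffixSum (multichoose m) total π) orders
        ≈⟨ ∑-cong-All (All.map (λ {π} → by-parts π) orders-length) ⟩
      ∑ (λ π → w r · total π) orders
        ≈⟨ ∑-· (w r) total orders ⟩
      w r · allMatched ∎
      where
      open ≈-Reasoning setoid
      w = multichoose (suc m)
      by-parts : ∀ π → length π ≡ r →
        sum (λ j → stepSum w (at j (gain j)) π) + suffixSum (multichoose m) total π ≈ w r · total π
      by-parts π |π|≡r = begin
        sum (λ j → stepSum w (at j (gain j)) π) + suffixSum (multichoose m) total π
          ≈⟨ +-congʳ (trans (sum-stepSum w (λ j → at j (gain j)) π)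
               (stepSum-cong w (λ h ρ → sum-[≟] h (λ j → gain j ρ)) π)) ⟩
        stepSum w gain π + suffixSum (multichoose m) total π
          ≈⟨ summation-by-parts m refl (λ _ _ → refl) π ⟩
        w (length π) · total π
          ≈⟨ ×-congˡ (≡.cong w |π|≡r) ⟩
        w r · total π ∎

    -- Sums `greedy-edge` over the histories of `σ`, none of which contains `j`, and then inserts
    -- `j` everywhere. The gain terms transfer exactly; the level terms, multiplied by `K`, do not
    -- decrease in total.
    dual-insertions : ∀ m {i j} → i ∈ nbhd j → ∀ σ → Fresh j σ →
      (suc (suc m ℕ.+ length σ) ℕ.* multichoose (2 ℕ.+ m) (length σ)) · 1# ≤
      ∑ (suffixSum (multichoose (suc m)) (level i)) (insertions j σ)
        + suc (suc m ℕ.+ length σ) · ∑ (stepSum (multichoose (suc m)) (at j (gain j))) (insertions j σ)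
    dual-insertions m {i} {j} i∈N σ jσ! = begin
      (K ℕ.* multichoose (2 ℕ.+ m) (length σ)) · 1#
        ≈⟨ ×-assocˡ 1# K (multichoose (2 ℕ.+ m) (length σ)) ⟨
      K · (multichoose (2 ℕ.+ m) (length σ) · 1#)
        ≈⟨ ×-congʳ K (suffixSum-const (suc m) 1# σ) ⟨
      K · suffixSum w (λ _ → 1#) σ
        ≲⟨ ·-monoʳ-≤ K (suffixSum-mono-≤ w Fresh-tail (λ _ → greedy-edge i∈N) σ jσ!) ⟩
      K · suffixSum w (λ ρ → level i ρ + gain j ρ) σ
        ≈⟨ trans (×-congʳ K (suffixSum-+ w (level i) (gain j) σ)) (×-distrib-+ _ _ K) ⟩
      K · suffixSum w (level i) σ + K · suffixSum w (gain j) σ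
        ≈⟨ +-congˡ (×-congʳ K (stepSum-at-insertions w j (gain j) (head jσ!))) ⟨
      K · suffixSum w (level i) σ + K · ∑ (stepSum w (at j (gain j))) (insertions j σ)
        ≲⟨ +-monoˡ-≤ _ (suffixSum-insertions (suc m) j Fresh-tail
             (λ ρ jρ! → All.map (λ ρ≤π → ρ≤π i) (level-insertions j ρ jρ!)) σ jσ!) ⟩
      ∑ (suffixSum w (level i)) (insertions j σ) + K · ∑ (stepSum w (at j (gain j))) (insertions j σ) ∎
      where
      open ≤-Reasoning
      K = suc (suc m ℕ.+ length σ)
      w = multichoose (suc m)

    allFin-remove : ∀ j → ∃ λ rest → allFin r ↭ j ∷ rest
    allFin-remove j with ∈-∃++ (∈-allFin j)
    ... | ys , zs , allFin≡ = ys ++ zs , ≡.subst (_↭ j ∷ ys ++ zs) (≡.sym allFin≡) (shift j ys zs)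

    -- The orders are grouped by the order `σ` of the vertices other than `j`, and `dual-insertions`
    -- is summed over the groups.
    dual-feasible : ∀ m i j → i ∈ nbhd j →
      (r ! ℕ.* multichoose (2 ℕ.+ m) r) · 1# ≤ offlineDual m i + suc (m ℕ.+ r) · onlineDual m j
    dual-feasible m i j i∈N = begin
      (r ! ℕ.* multichoose (2 ℕ.+ m) r) · 1#
        ≡⟨ ≡.cong (λ r → (r ! ℕ.* multichoose (2 ℕ.+ m) r) · 1#) r≡1+k ⟩
      (suc k ! ℕ.* multichoose (2 ℕ.+ m) (suc k)) · 1#
        ≈⟨ ×-congˡ weights ⟩
      (k ! ℕ.* (K ℕ.* multichoose (2 ℕ.+ m) k)) · 1#
        ≈⟨ ×-assocˡ 1# (k !) _ ⟨
      (k !) · ((K ℕ.* multichoose (2 ℕ.+ m) k) · 1#)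
        ≈⟨ ∑-const-permutations _ rest ⟨
      ∑ (λ _ → (K ℕ.* multichoose (2 ℕ.+ m) k) · 1#) (permutations rest)
        ≲⟨ ∑-mono-≤ (All.map insert (permutations-↭ rest)) ⟩
      ∑ (λ σ → ∑ f (insertions j σ) + K · ∑ g (insertions j σ)) (permutations rest)
        ≈⟨ trans (∑-+ _ _ (permutations rest)) (+-congˡ (∑-· K _ (permutations rest))) ⟩
      ∑ (λ σ → ∑ f (insertions j σ)) (permutations rest)
        + K · ∑ (λ σ → ∑ g (insertions j σ)) (permutations rest)
        ≈⟨ +-cong (gather f) (×-congʳ K (gather g)) ⟩
      offlineDual m i + K · onlineDual m j
        ≡⟨ ≡.cong (λ n → offlineDual m i + suc n · onlineDual m j)
             (≡.trans (≡.sym (ℕₚ.+-suc m k)) (≡.cong (m ℕ.+_) (≡.sym r≡1+k))) ⟩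
      offlineDual m i + suc (m ℕ.+ r) · onlineDual m j ∎
      where
      open ≤-Reasoning
      rest = proj₁ (allFin-remove j)
      allFin↭ = proj₂ (allFin-remove j)
      k = length rest
      K = suc (suc m ℕ.+ k)
      f = suffixSum (multichoose (suc m)) (level i)
      g = stepSum (multichoose (suc m)) (at j (gain j))
      r≡1+k : r ≡ suc k
      r≡1+k = ≡.trans (≡.sym length-allFin) (↭-length allFin↭)
      -- The factor `suc k` of the factorial is absorbed into the coefficient and yields `K`.
      weights : suc k ! ℕ.* multichoose (2 ℕ.+ m) (suc k) ≡ k ! ℕ.* (K ℕ.* multichoose (2 ℕ.+ m) k)
      weights = ≡.trans
        (≡.cong (ℕ._* multichoose (2 ℕ.+ m) (suc k)) (ℕₚ.*-comm (suc k) (k !)))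
        (≡.trans (ℕₚ.*-assoc (k !) (suc k) _)
          (≡.cong (k ! ℕ.*_) (multichoose-absorb (2 ℕ.+ m) k)))
      insert : ∀ {σ} → σ ↭ rest → (K ℕ.* multichoose (2 ℕ.+ m) k) · 1# ≤
        ∑ f (insertions j σ) + K · ∑ g (insertions j σ)
      insert {σ} σ↭rest = ≡.subst
        (λ k → (suc (suc m ℕ.+ k) ℕ.* multichoose (2 ℕ.+ m) k) · 1# ≤
               ∑ f (insertions j σ) + suc (suc m ℕ.+ k) · ∑ g (insertions j σ))
        (↭-length σ↭rest)
        (dual-insertions m i∈N σ
          (Unique-resp (↭-trans allFin↭ (prep j (↭-sym σ↭rest))) (Unique.allFin⁺ r)))
      gather : ∀ f → ∑ (λ σ → ∑ f (insertions j σ)) (permutations rest) ≈ ∑ f orders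
      gather f = trans (sym (∑-permutations-∷ f j rest)) (∑-permutations-↭ (↭-sym allFin↭) f)

    -- The recurrence and the resulting bound at `e`.

    module _ {y : Fin l → Fin r → Carrier} (M : IsFractionalMatching G y) where

      -- Weak duality for the dual solution whose online part is scaled by `K`. Adding
      -- `K · historyMatched m` to both sides lets `sum-onlineDual` eliminate that part.
      historyMatched-recurrence : ∀ m →
        (r ! ℕ.* multichoose (2 ℕ.+ m) r) · value G y + suc (m ℕ.+ r) · historyMatched m ≤
        historyMatched (suc m) + (suc (m ℕ.+ r) ℕ.* multichoose (suc m) r) · allMatched
      historyMatched-recurrence m = begin
        C · value G y + K · historyMatched m
          ≈⟨ +-congʳ (·1-* C (value G y)) ⟨
        (C · 1#) * value G y + K · historyMatched m
          ≲⟨ +-monoˡ-≤ _ (weak-duality G M (C · 1#) (offlineDual m) (λ j → K · onlineDual m j)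
               (offlineDual-nonneg m) (λ j → ·-nonneg-≤ K (onlineDual-nonneg m j))
               (dual-feasible m)) ⟩
        sum (offlineDual m) + sum (λ j → K · onlineDual m j) + K · historyMatched m
          ≈⟨ +-congʳ (+-cong (sum-offlineDual m) (sym (·-sum K (onlineDual m)))) ⟩
        historyMatched (suc m) + K · sum (onlineDual m) + K · historyMatched m
          ≈⟨ trans (+-assoc _ _ _) (+-congˡ (sym (×-distrib-+ _ _ K))) ⟩
        historyMatched (suc m) + K · (sum (onlineDual m) + historyMatched m)
          ≈⟨ +-congˡ (trans (×-congʳ K (sum-onlineDual m)) (×-assocˡ allMatched K (multichoose (suc m) r))) ⟩
        historyMatched (suc m) + (K ℕ.* multichoose (suc m) r) · allMatched ∎
        where
        open ≤-Reasoning
        C = r ! ℕ.* multichoose (2 ℕ.+ m) r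
        K = suc (m ℕ.+ r)

      value-nonneg : 0# ≤ value G y
      value-nonneg = sum-nonneg (λ i → sum-nonneg (IsFractionalMatching.nonneg M i))

      allMatched-bound : (r !) · value G y * e ≤ (r !) · value G y + allMatched * e
      allMatched-bound = bound-at-e (·-nonneg-≤ (r !) value-nonneg)
        (partial-sum-bound r historyMatched (historyMatched-nonneg 0)
          historyMatched-≤ historyMatched-recurrence)

theorem3 :
    ∀ {c ℓ₁ ℓ₂} (ℝ : RealNumbers c ℓ₁ ℓ₂) →
    let open RealArithmetic ℝ
        open OnlineMatching ℝ
    in
    ∀ {V : Set} {l : ℕ} (A : OnlineAlgorithm V l) →
    Greedy A → AllocationMonotone A →
    ∀ (G : BipartiteGraph V l) (opt : Carrier) → IsOPT G opt →
    ((e - 1#) / e [ >⇒#0 0<e ]) * opt ≤ expectedMatched A G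
theorem3 ℝ A greedy allocation-monotone G opt ((y , M , y≈opt) , _) =
  -- Multiplication by `r! * e` clears both divisions.
  *-cancelˡ-≤ (*-pos 0<r! 0<e) (begin
    (r! * e) * ((e - 1#) / e [ >⇒#0 0<e ] * opt)
      ≈⟨ solve 4 (λ f e q o → (f :* e) :* (q :* o) := (e :* q) :* (f :* o)) refl r! e _ opt ⟩
    (e * ((e - 1#) / e [ >⇒#0 0<e ])) * (r! * opt)
      ≈⟨ *-cong (*-/ (e - 1#) (>⇒#0 0<e)) (trans (·1-* (r !) opt) (×-congʳ (r !) (sym y≈opt))) ⟩
    (e - 1#) * O
      -- This is `allMatched-bound` with `O` cancelled, as (e - 1) O + O = O e.
      ≲⟨ +-cancelʳ-≤ O (≤-trans (≈⇒≤ (e-1+1 O)) (≤-trans allMatched-bound′ (≈⇒≤ (+-comm _ _)))) ⟩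
    allMatched * e
      ≈⟨ *-congʳ (*-/ allMatched (!·1#0 r)) ⟨
    r! * (allMatched / r! [ !·1#0 r ]) * e
      ≈⟨ solve 3 (λ f e q → (f :* q) :* e := (f :* e) :* q) refl r! e _ ⟩
    (r! * e) * expectedMatched A G ∎)
  where
  open RealArithmetic ℝ
  open OnlineMatching ℝ
  open OrderedField ℝ
  open ≤-Reasoning
  open BipartiteGraph G using (r)
  open RandomOrder ℝ A greedy allocation-monotone G using (allMatched; allMatched-bound)
  r! O : Carrier
  r! = (r !) · 1#
  O = (r !) · value G y
  0<r! : 0# < r!
  0<r! = ·-pos (r !) {{r ℕₚ.!≢0}} 0<1
  allMatched-bound′ = allMatched-bound M
  e-1+1 : ∀ z → (e - 1#) * z + z ≈ z * e
  e-1+1 z = trans (+-congˡ (sym (*-identityˡ z)))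
    (trans (sym (distribʳ z _ _)) (trans (*-congʳ (x-y+y≈x e 1#)) (*-comm e z)))
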